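{- Let $G$ be a connected weighted graph of order $n\ge 3$. Then $$K(G)\ \ge\ \frac{1}{2\phi(G)}+\frac{(n-2)^2}{n},$$ and equality cannot occur.
   Context: Graphs are finite, simple, connected, undirected and weighted: $G=(V,E,c)$ with symmetric weights $c(i,j)=c_{ij}=c_{ji}>0$ if $\{i,j\}\in E$ and $c_{ij}=0$ otherwise (no loops), $|V|=n$. The degree of vertex $i$ is $k_i=\sum_j c_{ij}$, $D=\operatorname{diag}(k_1,\dots,k_n)$, $A=(c_{ij})$ is the adjacency matrix. For $S\subseteq V$, $\operatorname{vol}(S)=\sum_{i\in S}k_i$ and $\bar S=V\setminus S$. The conductance of $G$ is $$\phi(G)=\min_{\emptyset\ne S\subsetneq V}\frac{\sum_{u\in S,v\in\bar S}c_{uv}}{\min(\operatorname{vol}(S),\operatorname{vol}(\bar S))}.$$ The normalized adjacency matrix is $M_G=D^{ -1/2}AD^{ -1/2}$, with eigenvalues $1=\lambda_1>\lambda_2\ge\cdots\ge\lambda_n\ge-1$. Kemeny's constant is $K(G)=\sum_i\pi_i m_{ji}-1$ for the random walk with transition matrix $D^{ -1}A$, where $\pi$ is the stationary distribution and $m_{ji}$ the mean first passage time from $j$ to $i$ (with $m_{jj}$ the mean first return time); this does not depend on $j$, and it is known that $K(G)=\sum_{j=2}^{n}\frac{1}{1-\lambda_j}$. -}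

module Defs where

open import Level using (Level; 0ℓ; _⊔_) renaming (suc to lsuc)
open import Algebra.Apartness.Bundles using (HeytingField; HeytingCommutativeRing)
open import Algebra.Bundles using (CommutativeRing)
import Algebra.Properties.CommutativeMonoid.Sum as Sums
import Algebra.Properties.Semiring.Mult as Mult
open import Data.Bool.Base using (Bool; true; false; if_then_else_)
open import Data.Fin.Base using (Fin; zero; suc)
open import Data.Fin.Properties using () renaming (_≟_ to _≟ᶠ_)
open import Data.Fin.Subset using (Subset; inside; outside; Nonempty; _∈_; _⊂_; ⊤; ∁; ⁅_⁆)
open import Data.Fin.Subset.Properties
  using (nonempty?; _⊂?_; _∈?_; ∈⊤; ⊆⊤; x∈⁅x⁆; x∈⁅y⁆⇒x≡y; x∉p⇒x∈∁p; x∈∁p⇒x∉p)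
open import Data.List.Base using (List; []; _∷_; _++_; map; mapMaybe)
open import Data.List.NonEmpty.Base using (List⁺; foldr₁) renaming (_∷_ to _∷⁺_; map to map⁺)
open import Data.Maybe.Base using (Maybe; just; nothing)
open import Data.Nat.Base as ℕ using (ℕ; zero; suc; s≤s; z≤n)
open import Data.Product.Base using (Σ-syntax; ∃; ∃-syntax; _×_; _,_; proj₁; proj₂)
open import Data.Sum.Base using (_⊎_; inj₁; inj₂)
import Data.Vec.Base as Vec
open import Data.Vec.Properties using ([]=⇒lookup)
open import Relation.Binary.Core using (Rel)
open import Relation.Binary.Definitions using (Decidable; Symmetric; Irreflexive; Cotransitive)
open import Relation.Binary.Lattice.Definitions using (Infimum)
open import Relation.Binary.Structures using (IsStrictPartialOrder)
open import Relation.Binary.Construct.Closure.ReflexiveTransitive using (Star; ε; _◅_)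
open import Relation.Binary.PropositionalEquality.Core as ≡ using (_≡_; _≢_)
open import Relation.Nullary.Decidable using (yes; no; does)
open import Relation.Nullary.Negation using (¬_; contradiction)

-- The real numbers, axiomatised as a Cauchy-complete Archimedean ordered
-- field.  The order is not assumed decidable, so that constructive reals are
-- a model; classically every model is isomorphic to ℝ.
record RealField c ℓ₁ ℓ₂ : Set (lsuc (c ⊔ ℓ₁ ⊔ ℓ₂)) where
  infix  4 _<_ _≤_
  infixl 7 _⊓_
  field
    heytingField : HeytingField c ℓ₁ ℓ₂

  open HeytingField heytingField public renaming (zero to *-zero)
  open HeytingCommutativeRing heytingCommutativeRing public using (commutativeRing)
  open CommutativeRing commutativeRing public using (semiring; +-commutativeMonoid)
  open Mult semiring public using () renaming (_×_ to _·_)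
  open Sums +-commutativeMonoid public using (sum)

  field
    _<_                  : Rel Carrier ℓ₂
    isStrictPartialOrder : IsStrictPartialOrder _≈_ _<_
    <⇒#                  : ∀ {x y} → x < y → x # y
    #⇒<⊎>                : ∀ {x y} → x # y → x < y ⊎ y < x
    0<1                  : 0# < 1#
    +-monoˡ-<            : ∀ z {x y} → x < y → x + z < y + z
    *-pos                : ∀ {x y} → 0# < x → 0# < y → 0# < x * y

  _≤_ : Rel Carrier ℓ₂
  x ≤ y = ¬ (y < x)

  fromℕ : ℕ → Carrier
  fromℕ n = n · 1#

  IsLimit : (ℕ → Carrier) → Carrier → Set (c ⊔ ℓ₂)
  IsLimit s l = ∀ e → 0# < e → ∃[ N ] ∀ k → N ℕ.≤ k → (s k < l + e) × (l < s k + e)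

  IsCauchy : (ℕ → Carrier) → Set (c ⊔ ℓ₂)
  IsCauchy s = ∀ e → 0# < e → ∃[ N ] ∀ k l → N ℕ.≤ k → N ℕ.≤ l → s k < s l + e

  field
    _⊓_         : Carrier → Carrier → Carrier
    ⊓-infimum   : Infimum _≤_ _⊓_
    archimedean : ∀ x → ∃[ n ] (x < fromℕ n)
    complete    : ∀ s → IsCauchy s → ∃ (IsLimit s)

  partialSum : (ℕ → Carrier) → ℕ → Carrier
  partialSum a zero    = 0#
  partialSum a (suc N) = partialSum a N + a N

  HasSum : (ℕ → Carrier) → Carrier → Set (c ⊔ ℓ₂)
  HasSum a = IsLimit (partialSum a)

  -- #⇒invertible inverts y - 0#, which is ≈ y.
  inv : (y : Carrier) → 0# < y → Carrier
  inv y 0<y = proj₁ (#⇒invertible (#-sym (<⇒# 0<y)))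

  infixl 7 _/_[_]
  _/_[_] : Carrier → (y : Carrier) → 0# < y → Carrier
  x / y [ 0<y ] = x * inv y 0<y

  open IsStrictPartialOrder isStrictPartialOrder public
    using (<-respˡ-≈; <-respʳ-≈)
    renaming (irrefl to <-irrefl; trans to <-trans; asym to <-asym)

  <-cotrans : Cotransitive _<_
  <-cotrans {x} {y} x<y z with #-cotrans (<⇒# x<y) z
  ... | inj₁ x#z with #⇒<⊎> x#z
  ...   | inj₁ x<z = inj₁ x<z
  ...   | inj₂ z<x = inj₂ (<-trans z<x x<y)
  <-cotrans {x} {y} x<y z | inj₂ z#y with #⇒<⊎> z#y
  ...   | inj₁ z<y = inj₂ z<y
  ...   | inj₂ y<z = inj₁ (<-trans x<y y<z)

  <⇒≤ : ∀ {x y} → x < y → x ≤ y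
  <⇒≤ x<y y<x = <-asym x<y y<x

  ≤-reflexive : ∀ {x y} → x ≈ y → x ≤ y
  ≤-reflexive x≈y y<x = <-irrefl (sym x≈y) y<x

  <-≤-trans : ∀ {x y z} → x < y → y ≤ z → x < z
  <-≤-trans {z = z} x<y y≤z with <-cotrans x<y z
  ... | inj₁ x<z = x<z
  ... | inj₂ z<y = contradiction z<y y≤z

  ≤-<-trans : ∀ {x y z} → x ≤ y → y < z → x < z
  ≤-<-trans {x} x≤y y<z with <-cotrans y<z x
  ... | inj₁ y<x = contradiction y<x x≤y
  ... | inj₂ x<z = x<z

  ≤-trans : ∀ {x y z} → x ≤ y → y ≤ z → x ≤ z
  ≤-trans x≤y y≤z z<x = y≤z (<-≤-trans z<x x≤y)

  +-monoˡ-≤ : ∀ z {x y} → x ≤ y → x + z ≤ y + z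
  +-monoˡ-≤ z {x} {y} x≤y h =
    x≤y (<-respˡ-≈ (cancel y) (<-respʳ-≈ (cancel x) (+-monoˡ-< (- z) h)))
    where
    cancel : ∀ w → (w + z) + - z ≈ w
    cancel w = trans (+-assoc w z (- z))
                     (trans (+-congˡ (-‿inverseʳ z)) (+-identityʳ w))

  0≤+0≤ : ∀ {x y} → 0# ≤ x → 0# ≤ y → 0# ≤ x + y
  0≤+0≤ {x} {y} 0≤x 0≤y =
    ≤-trans 0≤y (≤-trans (≤-reflexive (sym (+-identityˡ y))) (+-monoˡ-≤ y 0≤x))

  0≤+0< : ∀ {x y} → 0# ≤ x → 0# < y → 0# < x + y
  0≤+0< {x} {y} 0≤x 0<y =
    <-≤-trans 0<y (≤-trans (≤-reflexive (sym (+-identityˡ y))) (+-monoˡ-≤ y 0≤x))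

  0<+0≤ : ∀ {x y} → 0# < x → 0# ≤ y → 0# < x + y
  0<+0≤ {x} {y} 0<x 0≤y = <-respʳ-≈ (+-comm y x) (0≤+0< 0≤y 0<x)

  sum-nonneg : ∀ {n} (f : Fin n → Carrier) → (∀ i → 0# ≤ f i) → 0# ≤ sum f
  sum-nonneg {zero}  f f≥0 = ≤-reflexive refl
  sum-nonneg {suc n} f f≥0 =
    0≤+0≤ (f≥0 zero) (sum-nonneg (λ i → f (suc i)) (λ i → f≥0 (suc i)))

  sum-pos : ∀ {n} (f : Fin n → Carrier) → (∀ i → 0# ≤ f i) →
            ∀ i → 0# < f i → 0# < sum f
  sum-pos f f≥0 zero    fi>0 =
    0<+0≤ fi>0 (sum-nonneg (λ i → f (suc i)) (λ i → f≥0 (suc i)))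
  sum-pos f f≥0 (suc i) fi>0 =
    0≤+0< (f≥0 zero) (sum-pos (λ i → f (suc i)) (λ i → f≥0 (suc i)) i fi>0)

  ⊓-pos : ∀ {x y} → 0# < x → 0# < y → 0# < x ⊓ y
  ⊓-pos {x} {y} 0<x 0<y with <-cotrans 0<x (x ⊓ y)
  ... | inj₁ 0<m = 0<m
  ... | inj₂ m<x with <-cotrans 0<y (x ⊓ y)
  ...   | inj₁ 0<m = 0<m
  ...   | inj₂ m<y = contradiction m<x (greatest x (≤-reflexive refl) x≤y)
    where
    greatest = proj₂ (proj₂ (⊓-infimum x y))
    x≤y : x ≤ y
    x≤y y<x = greatest y (<⇒≤ y<x) (≤-reflexive refl) m<y

  foldr₁-⊓-pos : ∀ {a} {A : Set a} (f : A → Carrier) → (∀ x → 0# < f x) →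
                 ∀ xs → 0# < foldr₁ _⊓_ (map⁺ f xs)
  foldr₁-⊓-pos f f>0 (x ∷⁺ xs) = go x xs
    where
    go : ∀ x xs → 0# < foldr₁ _⊓_ (map⁺ f (x ∷⁺ xs))
    go x []       = f>0 x
    go x (y ∷ xs) = ⊓-pos (f>0 x) (go y xs)

  x-0≈x : ∀ x → x - 0# ≈ x
  x-0≈x x = trans (sym (+-identityʳ (x - 0#)))
                  (trans (+-assoc x (- 0#) 0#)
                         (trans (+-congˡ (-‿inverseˡ 0#)) (+-identityʳ x)))

  inv-inverseˡ : ∀ y (0<y : 0# < y) → inv y 0<y * y ≈ 1#
  inv-inverseˡ y 0<y = trans (*-congˡ (sym (x-0≈x y)))
                             (proj₁ (proj₂ (#⇒invertible (#-sym (<⇒# 0<y)))))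

  inv-pos : ∀ y (0<y : 0# < y) → 0# < inv y 0<y
  inv-pos y 0<y with #⇒<⊎> (invertible⇒# {inv y 0<y} {0#} (y , left , right))
    where
    right : (inv y 0<y - 0#) * y ≈ 1#
    right = trans (*-congʳ (x-0≈x _)) (inv-inverseˡ y 0<y)
    left : y * (inv y 0<y - 0#) ≈ 1#
    left = trans (*-comm y _) right
  ... | inj₂ 0<w = 0<w
  ... | inj₁ w<0 = contradiction 0<1 (<⇒≤ 1<0)
    where
    w = inv y 0<y
    0<-w : 0# < - w
    0<-w = <-respˡ-≈ (-‿inverseʳ w) (<-respʳ-≈ (+-identityˡ (- w)) (+-monoˡ-< (- w) w<0))
    sum≈0 : (- w) * y + 1# ≈ 0#
    sum≈0 = trans (+-congˡ (sym (inv-inverseˡ y 0<y)))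
                  (trans (sym (distribʳ y (- w) w))
                         (trans (*-congʳ (-‿inverseˡ w)) (zeroˡ y)))
    1<0 : 1# < 0#
    1<0 = <-respˡ-≈ (+-identityˡ 1#) (<-respʳ-≈ sum≈0 (+-monoˡ-< 1# (*-pos 0<-w 0<y)))

  fromℕ-pos : ∀ {n} → 1 ℕ.≤ n → 0# < fromℕ n
  fromℕ-pos {suc n} (s≤s z≤n) = 0<+0≤ 0<1 (nonneg n)
    where
    nonneg : ∀ n → 0# ≤ fromℕ n
    nonneg zero    = ≤-reflexive refl
    nonneg (suc n) = 0≤+0≤ (<⇒≤ 0<1) (nonneg n)

  twice-pos : ∀ {x} → 0# < x → 0# < fromℕ 2 * x
  twice-pos 0<x = *-pos (fromℕ-pos {2} (s≤s z≤n)) 0<x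

  /-pos : ∀ {x} y (0<y : 0# < y) → 0# < x → 0# < x / y [ 0<y ]
  /-pos y 0<y 0<x = *-pos 0<x (inv-pos y 0<y)

Cut : ℕ → Set
Cut n = Σ[ S ∈ Subset n ] (Nonempty S × S ⊂ ⊤)

allSubsets : ∀ n → List (Subset n)
allSubsets zero    = Vec.[] ∷ []
allSubsets (suc n) = map (outside Vec.∷_) (allSubsets n) ++ map (inside Vec.∷_) (allSubsets n)

toCut : ∀ {n} → Subset n → Maybe (Cut n)
toCut S with nonempty? S | S ⊂? ⊤
... | yes S≢∅ | yes S⊂V = just (S , S≢∅ , S⊂V)
... | _       | _       = nothing

-- All cuts; the cut {0} heads the list only to make it visibly non-empty, and
-- occurs in the tail again.
cuts : ∀ {n} → 2 ℕ.≤ n → List⁺ (Cut n)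
cuts {suc (suc n)} (s≤s (s≤s z≤n)) = first ∷⁺ mapMaybe toCut (allSubsets _)
  where
  first : Cut (suc (suc n))
  first = ⁅ zero ⁆ , (zero , x∈⁅x⁆ zero) , ⊆⊤ , suc zero , ∈⊤ ,
          λ 1∈ → contradiction (x∈⁅y⁆⇒x≡y zero 1∈) λ ()

module _ {c ℓ₁ ℓ₂} (R : RealField c ℓ₁ ℓ₂) where
  open RealField R

  record WeightedGraph (n : ℕ) : Set (lsuc 0ℓ ⊔ c ⊔ ℓ₁ ⊔ ℓ₂) where
    infix 4 _~_
    field
      _~_        : Rel (Fin n) 0ℓ
      _~?_       : Decidable _~_
      ~-sym      : Symmetric _~_
      ~-irrefl   : Irreflexive _≡_ _~_
      connected  : ∀ i j → Star _~_ i j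
      weight     : Fin n → Fin n → Carrier
      weight-sym : ∀ i j → weight i j ≈ weight j i
      weight-pos : ∀ {i j} → i ~ j → 0# < weight i j
      weight-0   : ∀ {i j} → ¬ i ~ j → weight i j ≈ 0#

module _ {c ℓ₁ ℓ₂} {R : RealField c ℓ₁ ℓ₂} {n : ℕ} (G : WeightedGraph R n) where
  open RealField R
  open WeightedGraph G

  sumOver : Subset n → (Fin n → Carrier) → Carrier
  sumOver S f = sum λ i → if Vec.lookup S i then f i else 0#

  degree : Fin n → Carrier
  degree i = sum λ j → weight i j

  vol : Subset n → Carrier
  vol S = sumOver S degree

  cutWeight : Subset n → Carrier
  cutWeight S = sumOver S λ u → sumOver (∁ S) λ v → weight u v

  weight-nonneg : ∀ i j → 0# ≤ weight i j
  weight-nonneg i j with i ~? j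
  ... | yes i~j = <⇒≤ (weight-pos i~j)
  ... | no  i≁j = ≤-reflexive (sym (weight-0 i≁j))

  sumOver-nonneg : ∀ S f → (∀ i → 0# ≤ f i) → 0# ≤ sumOver S f
  sumOver-nonneg S f f≥0 = sum-nonneg _ λ i → nonneg i (Vec.lookup S i)
    where
    nonneg : ∀ i (b : Bool) → 0# ≤ (if b then f i else 0#)
    nonneg i true  = f≥0 i
    nonneg i false = ≤-reflexive refl

  sumOver-pos : ∀ S f → (∀ i → 0# ≤ f i) → ∀ {i} → i ∈ S → 0# < f i → 0# < sumOver S f
  sumOver-pos S f f≥0 {i} i∈S fi>0 = sum-pos _ (λ j → nonneg j (Vec.lookup S j)) i
    (≡.subst (λ b → 0# < (if b then f i else 0#)) (≡.sym ([]=⇒lookup i∈S)) fi>0)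
    where
    nonneg : ∀ i (b : Bool) → 0# ≤ (if b then f i else 0#)
    nonneg i true  = f≥0 i
    nonneg i false = ≤-reflexive refl

  degree-pos : 2 ℕ.≤ n → ∀ i → 0# < degree i
  degree-pos 2≤n i with other 2≤n i
    where
    other : ∀ {m} → 2 ℕ.≤ m → (i : Fin m) → ∃[ j ] i ≢ j
    other (s≤s (s≤s z≤n)) zero    = suc zero , λ ()
    other (s≤s (s≤s z≤n)) (suc _) = zero , λ ()
  ... | j , i≢j with connected i j
  ...   | ε           = contradiction ≡.refl i≢j
  ...   | _◅_ {j = k} i~k _ = sum-pos (weight i) (weight-nonneg i) k (weight-pos i~k)

  crossingEdge : ∀ S {u v} → Star _~_ u v → u ∈ S → v ∈ ∁ S →
                 ∃[ i ] ∃[ j ] (i ∈ S × j ∈ ∁ S × i ~ j)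
  crossingEdge S ε u∈S u∈∁S = contradiction u∈S (x∈∁p⇒x∉p u∈∁S)
  crossingEdge S (_◅_ {j = w} u~w p) u∈S v∈∁S with w ∈? S
  ... | yes w∈S = crossingEdge S p w∈S v∈∁S
  ... | no  w∉S = _ , w , u∈S , x∉p⇒x∈∁p w∉S , u~w

  cutWeight-pos : ((S , _) : Cut n) → 0# < cutWeight S
  cutWeight-pos (S , (u , u∈S) , _ , v , _ , v∉S)
    with crossingEdge S (connected u v) u∈S (x∉p⇒x∈∁p v∉S)
  ... | i , j , i∈S , j∈∁S , i~j =
    sumOver-pos S _ (λ k → sumOver-nonneg (∁ S) _ (weight-nonneg k)) i∈S
      (sumOver-pos (∁ S) _ (weight-nonneg i) j∈∁S (weight-pos i~j))

  module _ (2≤n : 2 ℕ.≤ n) where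

    vol-pos : ∀ S → Nonempty S → 0# < vol S
    vol-pos S (i , i∈S) =
      sumOver-pos S degree (λ j → <⇒≤ (degree-pos 2≤n j)) i∈S (degree-pos 2≤n i)

    minVol-pos : ((S , _) : Cut n) → 0# < vol S ⊓ vol (∁ S)
    minVol-pos (S , S≢∅ , _ , v , _ , v∉S) =
      ⊓-pos (vol-pos S S≢∅) (vol-pos (∁ S) (v , x∉p⇒x∈∁p v∉S))

    cutRatio : Cut n → Carrier
    cutRatio C@(S , _) = cutWeight S / (vol S ⊓ vol (∁ S)) [ minVol-pos C ]

    conductance : Carrier
    conductance = foldr₁ _⊓_ (map⁺ cutRatio (cuts 2≤n))

    conductance-pos : 0# < conductance
    conductance-pos = foldr₁-⊓-pos cutRatio
      (λ C → /-pos _ (minVol-pos C) (cutWeight-pos C)) (cuts 2≤n)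

    transition : Fin n → Fin n → Carrier
    transition i j = weight i j / degree i [ degree-pos 2≤n i ]

    record IsStationary (π : Fin n → Carrier) : Set (c ⊔ ℓ₁ ⊔ ℓ₂) where
      field
        nonneg    : ∀ i → 0# ≤ π i
        total     : sum π ≈ 1#
        invariant : ∀ j → sum (λ i → π i * transition i j) ≈ π j

    -- firstPassage t i j is the probability that the walk started at i is
    -- at j for the first time after time 0 at time t (first-step analysis).
    firstPassage : ℕ → Fin n → Fin n → Carrier
    firstPassage zero          i j = 0#
    firstPassage (suc zero)    i j = transition i j
    firstPassage (suc (suc t)) i j =
      sum λ k → if does (k ≟ᶠ j) then 0# else transition i k * firstPassage (suc t) k j

    -- m i j is the expected first passage time ∑ t · P(T = t) from i to j; for
    -- i = j it is the expected first return time.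
    IsMeanFirstPassage : (Fin n → Fin n → Carrier) → Set (c ⊔ ℓ₂)
    IsMeanFirstPassage m =
      ∀ i j → HasSum (λ t → fromℕ t * firstPassage t i j) (m i j)

    -- K is the value computed from some starting vertex.  As a hypothesis this
    -- does not presuppose that the value is independent of that vertex.
    record IsKemenyConstant (K : Carrier) : Set (c ⊔ ℓ₁ ⊔ ℓ₂) where
      field
        π              : Fin n → Carrier
        m              : Fin n → Fin n → Carrier
        isStationary   : IsStationary π
        isMeanPassage  : IsMeanFirstPassage m
        start          : Fin n
        value          : K ≈ sum (λ i → π i * m start i) - 1#

{-# OPTIONS --safe #-}
-- Let h_t(s) be the mean hitting time of t from s and v the total volume.  One-step
-- analysis gives L h_t = deg - v δ_t for the Laplacian L = D - A, and ∑_t deg(t) h_t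
-- is harmonic, hence equal to the constant v K.  So v² K is the weighted energy
-- ∑_t deg(t) E(h_t, h_t), and any family of trial functions bounds it from below.
-- Trial functions built from the centred indicator u of S, with Rayleigh quotient
-- μ = E(u, u) / ∑ deg u², and from the point masses δ_t / deg(t) give
--   K ≥ 1/μ + (n-2)²/n + μ (n-2)²/n².
-- This replaces the spectral argument: 1/μ is the contribution of λ₂, and the second
-- term that of the remaining n - 2 eigenvalues, by Cauchy-Schwarz and the trace.
-- Finally 1/μ = vol S · vol S̄ / (v · cut) ≥ min (vol S, vol S̄) / (2 cut), and the
-- surplus μ (n-2)²/n² > 0 makes the inequality strict.

module Submission where

open import Defs
open import Algebra.Bundles using (CommutativeRing)
import Algebra.Properties.Ring as RingProperties
import Algebra.Properties.Semiring.Mult.TCOptimised as Mult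
import Algebra.Properties.Semiring.Sum as Sum
import Algebra.Solver.Ring
open import Algebra.Solver.Ring.AlmostCommutativeRing
  using (_-Raw-AlmostCommutative⟶_; fromCommutativeRing)
open import Data.Bool.Base using (true; false; if_then_else_; not)
open import Data.Fin.Base using (Fin; zero; suc)
open import Data.Fin.Properties using () renaming (_≟_ to _≟ᶠ_)
open import Data.Fin.Subset using (Subset; ∁)
open import Data.Fin.Subset.Properties using (x∉p⇒x∈∁p)
open import Data.Integer.Base as ℤ using (ℤ; +_; -[1+_])
import Data.Integer.Properties as ℤₚ
open import Data.List.Base using ([]; _∷_)
open import Data.List.NonEmpty.Base using (foldr₁; head) renaming (_∷_ to _∷⁺_; map to map⁺)
import Data.Maybe.Base as Maybe
open import Data.Nat.Base as ℕ using (ℕ; zero; suc; s≤s; z≤n)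
import Data.Nat.Properties as ℕₚ
open import Data.Product.Base using (_×_; _,_; proj₁; proj₂)
open import Data.Sum.Base using (inj₁; inj₂; [_,_]′)
open import Data.Vec.Base using (lookup)
open import Data.Vec.Properties using (lookup-map)
open import Relation.Binary.Construct.Closure.ReflexiveTransitive using (Star; ε; _◅_)
open import Relation.Binary.PropositionalEquality.Core as ≡ using (_≡_)
import Relation.Binary.Reasoning.Setoid as ≈-Reasoning
open import Relation.Nullary.Decidable using (yes; no; does; dec-true; dec⇒maybe)
open import Relation.Nullary.Negation using (¬_; contradiction)

-- Integer coefficients for the ring solver.

module IntegerCoefficients {c ℓ} (R : CommutativeRing c ℓ) where
  open CommutativeRing R
  open RingProperties ring using (-‿distribˡ-*; -‿distribʳ-*; -0#≈0#; -‿involutive; -‿+-comm)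
  open Mult semiring using (×-homo-+; ×1-homo-*; 1+×) renaming (_×_ to _·_)
  open ≈-Reasoning setoid

  -- The optimised multiple makes `1 · 1#` reduce to `1#`, so `con (+ 0)`, `con (+ 1)` and
  -- `con (+ 2)` evaluate by computation to `0#`, `1#` and `1# + 1#`.
  ⟦_⟧ℤ : ℤ → Carrier
  ⟦ + n ⟧ℤ      = n · 1#
  ⟦ -[1+ n ] ⟧ℤ = - (suc n · 1#)

  ⟦neg⟧ : ∀ i → ⟦ ℤ.- i ⟧ℤ ≈ - ⟦ i ⟧ℤ
  ⟦neg⟧ (+ zero)  = sym -0#≈0#
  ⟦neg⟧ (+ suc n) = refl
  ⟦neg⟧ -[1+ n ]  = sym (-‿involutive _)

  ⟦⊖⟧ : ∀ m n → ⟦ m ℤ.⊖ n ⟧ℤ ≈ m · 1# - n · 1#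
  ⟦⊖⟧ zero    zero    = sym (trans (+-congˡ -0#≈0#) (+-identityʳ 0#))
  ⟦⊖⟧ zero    (suc n) = sym (+-identityˡ _)
  ⟦⊖⟧ (suc m) zero    = sym (trans (+-congˡ -0#≈0#) (+-identityʳ _))
  ⟦⊖⟧ (suc m) (suc n) = begin
    ⟦ suc m ℤ.⊖ suc n ⟧ℤ              ≡⟨ ≡.cong ⟦_⟧ℤ (ℤₚ.[1+m]⊖[1+n]≡m⊖n m n) ⟩
    ⟦ m ℤ.⊖ n ⟧ℤ                      ≈⟨ ⟦⊖⟧ m n ⟩
    m · 1# - n · 1#                   ≈⟨ +-congʳ (+-identityˡ _) ⟨
    -- The inserted `1# - 1#` supplies one unit to each of the two multiples.
    0# + m · 1# - n · 1#              ≈⟨ +-congʳ (+-congʳ (-‿inverseʳ 1#)) ⟨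
    1# - 1# + m · 1# - n · 1#         ≈⟨ +-congʳ (+-assoc 1# (- 1#) _) ⟩
    1# + (- 1# + m · 1#) - n · 1#     ≈⟨ +-congʳ (+-congˡ (+-comm _ _)) ⟩
    1# + (m · 1# - 1#) - n · 1#       ≈⟨ +-congʳ (+-assoc 1# _ _) ⟨
    1# + m · 1# - 1# - n · 1#         ≈⟨ +-assoc _ _ _ ⟩
    1# + m · 1# + (- 1# - n · 1#)     ≈⟨ +-congˡ (-‿+-comm 1# _) ⟩
    1# + m · 1# - (1# + n · 1#)       ≈⟨ +-cong (1+× m 1#) (-‿cong (1+× n 1#)) ⟨
    suc m · 1# - suc n · 1#           ∎

  ⟦+⟧ : ∀ i j → ⟦ i ℤ.+ j ⟧ℤ ≈ ⟦ i ⟧ℤ + ⟦ j ⟧ℤ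
  ⟦+⟧ (+ m)    (+ n)    = ×-homo-+ 1# m n
  ⟦+⟧ (+ m)    -[1+ n ] = ⟦⊖⟧ m (suc n)
  ⟦+⟧ -[1+ m ] (+ n)    = trans (⟦⊖⟧ n (suc m)) (+-comm _ _)
  ⟦+⟧ -[1+ m ] -[1+ n ] = begin
    - (suc (suc (m ℕ.+ n)) · 1#)    ≡⟨ ≡.cong (λ k → - (suc k · 1#)) (ℕₚ.+-suc m n) ⟨
    - ((suc m ℕ.+ suc n) · 1#)      ≈⟨ -‿cong (×-homo-+ 1# (suc m) (suc n)) ⟩
    - (suc m · 1# + suc n · 1#)     ≈⟨ -‿+-comm _ _ ⟨
    - (suc m · 1#) - suc n · 1#     ∎

  ⟦+*⟧ : ∀ m j → ⟦ + m ℤ.* j ⟧ℤ ≈ m · 1# * ⟦ j ⟧ℤ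
  ⟦+*⟧ m (+ n)    = trans (reflexive (≡.cong ⟦_⟧ℤ (≡.sym (ℤₚ.pos-* m n)))) (×1-homo-* m n)
  ⟦+*⟧ m -[1+ n ] = begin
    ⟦ + m ℤ.* ℤ.- (+ suc n) ⟧ℤ    ≡⟨ ≡.cong ⟦_⟧ℤ (ℤₚ.neg-distribʳ-* (+ m) (+ suc n)) ⟨
    ⟦ ℤ.- (+ m ℤ.* + suc n) ⟧ℤ    ≈⟨ ⟦neg⟧ (+ m ℤ.* + suc n) ⟩
    - ⟦ + m ℤ.* + suc n ⟧ℤ        ≈⟨ -‿cong (⟦+*⟧ m (+ suc n)) ⟩
    - (m · 1# * (suc n · 1#))     ≈⟨ -‿distribʳ-* _ _ ⟩
    m · 1# * - (suc n · 1#)       ∎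

  ⟦*⟧ : ∀ i j → ⟦ i ℤ.* j ⟧ℤ ≈ ⟦ i ⟧ℤ * ⟦ j ⟧ℤ
  ⟦*⟧ (+ m)    j = ⟦+*⟧ m j
  ⟦*⟧ -[1+ m ] j = begin
    ⟦ ℤ.- (+ suc m) ℤ.* j ⟧ℤ    ≡⟨ ≡.cong ⟦_⟧ℤ (ℤₚ.neg-distribˡ-* (+ suc m) j) ⟨
    ⟦ ℤ.- (+ suc m ℤ.* j) ⟧ℤ    ≈⟨ ⟦neg⟧ (+ suc m ℤ.* j) ⟩
    - ⟦ + suc m ℤ.* j ⟧ℤ        ≈⟨ -‿cong (⟦+*⟧ (suc m) j) ⟩
    - (suc m · 1# * ⟦ j ⟧ℤ)     ≈⟨ -‿distribˡ-* _ _ ⟩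
    - (suc m · 1#) * ⟦ j ⟧ℤ     ∎

  -- To cancel terms the solver must recognise equal coefficients. Equality of reals is not assumed
  -- decidable, so the coefficients are taken in ℤ.
  ℤ-homomorphism : ℤ.+-*-rawRing -Raw-AlmostCommutative⟶ fromCommutativeRing R
  ℤ-homomorphism = record
    { ⟦_⟧    = ⟦_⟧ℤ
    ; +-homo = ⟦+⟧
    ; *-homo = ⟦*⟧
    ; -‿homo = ⟦neg⟧
    ; 0-homo = refl
    ; 1-homo = refl
    }

  open Algebra.Solver.Ring ℤ.+-*-rawRing (fromCommutativeRing R) ℤ-homomorphism
    (λ i j → Maybe.map (λ i≡j → reflexive (≡.cong ⟦_⟧ℤ i≡j)) (dec⇒maybe (i ℤₚ.≟ j)))
    public using (solve; _:=_; _:+_; _:-_; _:*_; :-_; con)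

-- Order, apartness and limits in the real field.

module OrderedField {c ℓ₁ ℓ₂} (R : RealField c ℓ₁ ℓ₂) where
  open RealField R
  open IntegerCoefficients commutativeRing
  open ≈-Reasoning setoid

  0<-⇒< : ∀ {x y} → 0# < y - x → x < y
  0<-⇒< {x} {y} 0<y-x = <-respˡ-≈ (+-identityˡ x)
    (<-respʳ-≈ (solve 2 (λ x y → y :- x :+ x := y) refl x y) (+-monoˡ-< x 0<y-x))

  <⇒0<- : ∀ {x y} → x < y → 0# < y - x
  <⇒0<- {x} x<y = <-respˡ-≈ (-‿inverseʳ x) (+-monoˡ-< (- x) x<y)

  0<-x : ∀ {x} → x < 0# → 0# < - x
  0<-x {x} x<0 = <-respʳ-≈ (+-identityˡ (- x)) (<⇒0<- x<0)

  ≤-respʳ-≈ : ∀ {x y z} → y ≈ z → x ≤ y → x ≤ z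
  ≤-respʳ-≈ y≈z x≤y z<x = x≤y (<-respˡ-≈ (sym y≈z) z<x)

  ≤⇒0≤- : ∀ {x y} → x ≤ y → 0# ≤ y - x
  ≤⇒0≤- {x} {y} x≤y y-x<0 =
    x≤y (0<-⇒< (<-respʳ-≈ (solve 2 (λ x y → :- (y :- x) := x :- y) refl x y) (0<-x y-x<0)))

  *-monoʳ-< : ∀ {z x y} → 0# < z → x < y → z * x < z * y
  *-monoʳ-< {z} {x} {y} 0<z x<y = 0<-⇒< (<-respʳ-≈
    (solve 3 (λ z x y → z :* (y :- x) := z :* y :- z :* x) refl z x y) (*-pos 0<z (<⇒0<- x<y)))

  *-cancelˡ-< : ∀ {z x y} → 0# < z → z * x < z * y → x < y
  *-cancelˡ-< {z} {x} {y} 0<z zx<zy =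
    <-respˡ-≈ (cancel x) (<-respʳ-≈ (cancel y) (*-monoʳ-< (inv-pos z 0<z) zx<zy))
    where
    cancel : ∀ w → inv z 0<z * (z * w) ≈ w
    cancel w = trans (sym (*-assoc _ z w)) (trans (*-congʳ (inv-inverseˡ z 0<z)) (*-identityˡ w))

  *-cancelˡ-≈ : ∀ {z x y} → 0# < z → z * x ≈ z * y → x ≈ y
  *-cancelˡ-≈ {z} {x} {y} 0<z zx≈zy = trans (sym (cancel x)) (trans (*-congˡ zx≈zy) (cancel y))
    where
    cancel : ∀ w → inv z 0<z * (z * w) ≈ w
    cancel w = trans (sym (*-assoc _ z w)) (trans (*-congʳ (inv-inverseˡ z 0<z)) (*-identityˡ w))

  0<z*x⇒0<x : ∀ {z x} → 0# < z → 0# < z * x → 0# < x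
  0<z*x⇒0<x {z} 0<z 0<zx = *-cancelˡ-< 0<z (<-respˡ-≈ (sym (zeroʳ z)) 0<zx)

  0≤z*x⇒0≤x : ∀ {z x} → 0# < z → 0# ≤ z * x → 0# ≤ x
  0≤z*x⇒0≤x {z} 0<z 0≤zx x<0 = 0≤zx (<-respʳ-≈ (zeroʳ z) (*-monoʳ-< 0<z x<0))

  ≈0-stable : ∀ {x} → ¬ x # 0# → x ≈ 0#
  ≈0-stable = proj₁ (tight _ _)

  -- If the product were negative, `x` could not be apart from zero: `x < 0#` is excluded, and
  -- `0# < x` would force `y < 0#`. Tightness then gives `x ≈ 0#` and a zero product.
  *-nonneg : ∀ {x y} → 0# ≤ x → 0# ≤ y → 0# ≤ x * y
  *-nonneg {x} {y} 0≤x 0≤y xy<0 =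
    <-irrefl (trans (*-congʳ (≈0-stable x¬#0)) (zeroˡ y)) xy<0
    where
    x¬#0 : ¬ x # 0#
    x¬#0 x#0 with #⇒<⊎> x#0
    ... | inj₁ x<0 = 0≤x x<0
    ... | inj₂ 0<x = 0≤y (*-cancelˡ-< 0<x (<-respʳ-≈ (sym (zeroʳ x)) xy<0))

  square-pos : ∀ {x} → x # 0# → 0# < x * x
  square-pos {x} x#0 with #⇒<⊎> x#0
  ... | inj₁ x<0 = <-respʳ-≈ (solve 1 (λ x → :- x :* :- x := x :* x) refl x) (*-pos (0<-x x<0) (0<-x x<0))
  ... | inj₂ 0<x = *-pos 0<x 0<x

  square-nonneg : ∀ x → 0# ≤ x * x
  square-nonneg x xx<0 = <-irrefl (trans (*-congʳ x≈0) (zeroˡ x)) xx<0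
    where
    x≈0 : x ≈ 0#
    x≈0 = ≈0-stable λ x#0 → <-asym xx<0 (square-pos x#0)

  -- The infimum is characterised for `≤` only. Cotransitivity leaves just the case where the
  -- minimum is strictly below both `x` and `y`, and this contradicts its being the greatest lower
  -- bound.
  ⊓-greatest-< : ∀ {x y z} → z < x → z < y → z < x ⊓ y
  ⊓-greatest-< {x} {y} {z} z<x z<y with <-cotrans z<x (x ⊓ y)
  ... | inj₁ z<m = z<m
  ... | inj₂ m<x with <-cotrans z<y (x ⊓ y)
  ...   | inj₁ z<m = z<m
  ...   | inj₂ m<y = contradiction m<x (greatest x (≤-reflexive refl) x≤y)
    where
    greatest = proj₂ (proj₂ (⊓-infimum x y))
    x≤y : x ≤ y
    x≤y y<x = greatest y (<⇒≤ y<x) (≤-reflexive refl) m<y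

  foldr₁-⊓-greatest-< : ∀ {a} {A : Set a} (f : A → Carrier) {z} → (∀ x → z < f x) →
                        ∀ xs → z < foldr₁ _⊓_ (map⁺ f xs)
  foldr₁-⊓-greatest-< f {z} z<f (x ∷⁺ xs) = go x xs
    where
    go : ∀ x xs → z < foldr₁ _⊓_ (map⁺ f (x ∷⁺ xs))
    go x []       = z<f x
    go x (y ∷ xs) = ⊓-greatest-< (z<f x) (go y xs)

  -- Coincides by computation with `con (+ 2)`. In contrast `fromℕ 2` unfolds to `1# + (1# + 0#)`,
  -- and is spelled out that way in the solver calls that meet it.
  2# : Carrier
  2# = 1# + 1#

  0<2 : 0# < 2#
  0<2 = 0<+0≤ 0<1 (<⇒≤ 0<1)

  -- Limits of sequences

  half : Carrier → Carrier
  half x = x / 2# [ 0<2 ]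

  half-pos : ∀ {x} → 0# < x → 0# < half x
  half-pos = /-pos 2# 0<2

  half+half : ∀ x → half x + half x ≈ x
  half+half x = begin
    x * w + x * w  ≈⟨ solve 2 (λ x w → x :* w :+ x :* w := x :* (w :* con (+ 2))) refl x w ⟩
    x * (w * 2#)   ≈⟨ *-congˡ (inv-inverseˡ 2# 0<2) ⟩
    x * 1#         ≈⟨ *-identityʳ x ⟩
    x              ∎
    where w = inv 2# 0<2

  <-sum : ∀ {x y z w} → x < y → z < w → x + z < y + w
  <-sum {x} {y} {z} {w} x<y z<w = <-trans (+-monoˡ-< z x<y)
    (<-respˡ-≈ (+-comm z y) (<-respʳ-≈ (+-comm w y) (+-monoˡ-< y z<w)))

  IsLimit-cong : ∀ {s t l} → (∀ k → s k ≈ t k) → IsLimit s l → IsLimit t l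
  IsLimit-cong s≈t lim e 0<e with lim e 0<e
  ... | N , close = N , λ k N≤k →
    <-respˡ-≈ (s≈t k) (proj₁ (close k N≤k)) , <-respʳ-≈ (+-congʳ (s≈t k)) (proj₂ (close k N≤k))

  IsLimit-congʳ : ∀ {s l m} → l ≈ m → IsLimit s l → IsLimit s m
  IsLimit-congʳ l≈m lim e 0<e with lim e 0<e
  ... | N , close = N , λ k N≤k →
    <-respʳ-≈ (+-congʳ l≈m) (proj₁ (close k N≤k)) , <-respˡ-≈ l≈m (proj₂ (close k N≤k))

  IsLimit-suc : ∀ {s l} → IsLimit s l → IsLimit (λ k → s (suc k)) l
  IsLimit-suc lim e 0<e with lim e 0<e
  ... | N , close = N , λ k N≤k → close (suc k) (ℕₚ.m≤n⇒m≤1+n N≤k)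

  IsLimit-const : ∀ x → IsLimit (λ _ → x) x
  IsLimit-const x e 0<e = 0 , λ _ _ → x<x+e , x<x+e
    where
    x<x+e : x < x + e
    x<x+e = 0<-⇒< (<-respʳ-≈ (solve 2 (λ x e → e := x :+ e :- x) refl x e) 0<e)

  IsLimit-+ : ∀ {s t l m} → IsLimit s l → IsLimit t m → IsLimit (λ k → s k + t k) (l + m)
  IsLimit-+ {s} {t} {l} {m} lim₁ lim₂ e 0<e with lim₁ (half e) (half-pos 0<e) | lim₂ (half e) (half-pos 0<e)
  ... | N₁ , close₁ | N₂ , close₂ = N₁ ℕ.⊔ N₂ , λ k N≤k →
    let p = close₁ k (ℕₚ.≤-trans (ℕₚ.m≤m⊔n N₁ N₂) N≤k)
        q = close₂ k (ℕₚ.≤-trans (ℕₚ.m≤n⊔m N₁ N₂) N≤k)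
    in <-respʳ-≈ (regroup l m) (<-sum (proj₁ p) (proj₁ q))
     , <-respʳ-≈ (regroup (s k) (t k)) (<-sum (proj₂ p) (proj₂ q))
    where
    regroup : ∀ x y → (x + half e) + (y + half e) ≈ (x + y) + e
    regroup x y = trans
      (solve 3 (λ x y h → (x :+ h) :+ (y :+ h) := (x :+ y) :+ (h :+ h)) refl x y (half e))
      (+-congˡ (half+half e))

  IsLimit-neg : ∀ {s l} → IsLimit s l → IsLimit (λ k → - s k) (- l)
  IsLimit-neg {s} {l} lim e 0<e with lim e 0<e
  ... | N , close = N , λ k N≤k →
      flip (proj₂ (close k N≤k)) , flip (proj₁ (close k N≤k))
    where
    flip : ∀ {x y} → x < y + e → - y < - x + e
    flip {x} {y} x<y+e = 0<-⇒< (<-respʳ-≈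
      (solve 3 (λ x y e → y :+ e :- x := :- x :+ e :- :- y) refl x y e) (<⇒0<- x<y+e))

  IsLimit-*ˡ : ∀ {x s l} → 0# < x → IsLimit s l → IsLimit (λ k → x * s k) (x * l)
  IsLimit-*ˡ {x} {s} {l} 0<x lim e 0<e with lim (e / x [ 0<x ]) (/-pos x 0<x 0<e)
  ... | N , close = N , λ k N≤k → scale (proj₁ (close k N≤k)) , scale (proj₂ (close k N≤k))
    where
    scale : ∀ {y z} → y < z + e / x [ 0<x ] → x * y < x * z + e
    scale {y} {z} y< = <-respʳ-≈ (begin
      x * (z + e * w)
        ≈⟨ solve 4 (λ x z e w → x :* (z :+ e :* w) := x :* z :+ e :* (w :* x)) refl x z e w ⟩
      x * z + e * (w * x)  ≈⟨ +-congˡ (trans (*-congˡ (inv-inverseˡ x 0<x)) (*-identityʳ e)) ⟩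
      x * z + e            ∎) (*-monoʳ-< 0<x y<)
      where w = inv x 0<x

  IsLimit-sum : ∀ {n} {s : Fin n → ℕ → Carrier} {l : Fin n → Carrier} →
                (∀ i → IsLimit (s i) (l i)) → IsLimit (λ k → sum (λ i → s i k)) (sum l)
  IsLimit-sum {zero}  lim = IsLimit-const 0#
  IsLimit-sum {suc n} lim = IsLimit-+ (lim zero) (IsLimit-sum (λ i → lim (suc i)))

  -- With `e` half the gap `m - l`, a common late index gives `s k < l + e` and `m < s k + e`. The
  -- two sides of the sum of these inequalities are equal.
  IsLimit-≮ : ∀ {s l m} → IsLimit s l → IsLimit s m → ¬ l < m
  IsLimit-≮ {s} {l} {m} lim₁ lim₂ l<m with lim₁ e 0<e | lim₂ e 0<e
    where
    e = half (m - l)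
    0<e = half-pos (<⇒0<- l<m)
  ... | N₁ , close₁ | N₂ , close₂ =
    <-irrefl gap (<-sum (proj₁ (close₁ k (ℕₚ.m≤m⊔n N₁ N₂))) (proj₂ (close₂ k (ℕₚ.m≤n⊔m N₁ N₂))))
    where
    k = N₁ ℕ.⊔ N₂
    e = half (m - l)
    gap : s k + m ≈ (l + e) + (s k + e)
    gap = begin
      s k + m                ≈⟨ solve 3 (λ a l m → a :+ m := l :+ a :+ (m :- l)) refl (s k) l m ⟩
      l + s k + (m - l)      ≈⟨ +-congˡ (half+half (m - l)) ⟨
      l + s k + (e + e)      ≈⟨ solve 3 (λ a l e → l :+ a :+ (e :+ e) := l :+ e :+ (a :+ e)) refl (s k) l e ⟩
      (l + e) + (s k + e)    ∎

  IsLimit-unique : ∀ {s l m} → IsLimit s l → IsLimit s m → l ≈ m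
  IsLimit-unique {l = l} {m} lim₁ lim₂ = proj₁ (tight l m) λ l#m →
    [ IsLimit-≮ lim₁ lim₂ , IsLimit-≮ lim₂ lim₁ ]′ (#⇒<⊎> l#m)

-- Finite sums and the Kronecker delta.

module FiniteSums {c ℓ₁ ℓ₂} (R : RealField c ℓ₁ ℓ₂) where
  open RealField R
  open IntegerCoefficients commutativeRing
  open Sum semiring using (sum-cong-≋; ∑-distrib-+; *-distribˡ-sum; sum-replicate)
  open ≈-Reasoning setoid

  δ : ∀ {n} → Fin n → Fin n → Carrier
  δ i j = if does (i ≟ᶠ j) then 1# else 0#

  δ-diag : ∀ {n} (i : Fin n) → δ i i ≈ 1#
  δ-diag i = reflexive (≡.cong (if_then 1# else 0#) (dec-true (i ≟ᶠ i) ≡.refl))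

  sum-*ˡ : ∀ {n} x (f : Fin n → Carrier) → sum (λ i → x * f i) ≈ x * sum f
  sum-*ˡ x f = sym (*-distribˡ-sum x f)

  sum-const : ∀ {n} x → sum {n} (λ _ → x) ≈ fromℕ n * x
  sum-const {n} x = begin
    sum {n} (λ _ → x)       ≈⟨ sum-cong-≋ {n} (λ _ → sym (*-identityʳ x)) ⟩
    sum {n} (λ _ → x * 1#)  ≈⟨ sum-*ˡ {n} x _ ⟩
    x * sum {n} (λ _ → 1#)  ≈⟨ *-congˡ (sum-replicate n) ⟩
    x * fromℕ n             ≈⟨ *-comm x _ ⟩
    fromℕ n * x             ∎

  sum-0 : ∀ {n} {f : Fin n → Carrier} → (∀ i → f i ≈ 0#) → sum f ≈ 0#
  sum-0 {n} f≈0 = trans (sum-cong-≋ f≈0) (trans (sum-const {n} 0#) (zeroʳ _))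

  sum-lin : ∀ {n} x y (f g : Fin n → Carrier) →
            sum (λ i → x * f i + y * g i) ≈ x * sum f + y * sum g
  sum-lin x y f g = trans (∑-distrib-+ (λ i → x * f i) (λ i → y * g i)) (+-cong (sum-*ˡ x f) (sum-*ˡ y g))

  sum-minus : ∀ {n} (f g : Fin n → Carrier) → sum (λ i → f i - g i) ≈ sum f - sum g
  sum-minus f g = begin
    sum (λ i → f i - g i)
      ≈⟨ sum-cong-≋ (λ i → solve 2 (λ x y → x :- y := con (+ 1) :* x :+ (:- con (+ 1)) :* y)
          refl (f i) (g i)) ⟩
    sum (λ i → 1# * f i + - 1# * g i)       ≈⟨ sum-lin 1# (- 1#) f g ⟩
    1# * sum f + - 1# * sum g
      ≈⟨ solve 2 (λ x y → con (+ 1) :* x :+ (:- con (+ 1)) :* y := x :- y) refl (sum f) (sum g) ⟩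
    sum f - sum g                           ∎

  sum-δ : ∀ {n} (j : Fin n) f → sum (λ k → δ k j * f k) ≈ f j
  sum-δ zero f = trans (+-cong (*-identityˡ _) (sum-0 (λ k → zeroˡ (f (suc k))))) (+-identityʳ _)
  sum-δ (suc j) f = trans (+-cong (zeroˡ _) (sum-δ j (λ k → f (suc k)))) (+-identityˡ _)

  sum-split : ∀ {n} (j : Fin n) f → sum f ≈ f j + sum (λ k → if does (k ≟ᶠ j) then 0# else f k)
  sum-split j f = begin
    sum f
      ≈⟨ sum-cong-≋ (λ k → split (does (k ≟ᶠ j)) (f k)) ⟩
    sum (λ k → δ k j * f k + (if does (k ≟ᶠ j) then 0# else f k))
      ≈⟨ ∑-distrib-+ (λ k → δ k j * f k) _ ⟩
    sum (λ k → δ k j * f k) + sum (λ k → if does (k ≟ᶠ j) then 0# else f k)          ≈⟨ +-congʳ (sum-δ j f) ⟩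
    f j + sum (λ k → if does (k ≟ᶠ j) then 0# else f k)                              ∎
    where
    split : ∀ b x → x ≈ (if b then 1# else 0#) * x + (if b then 0# else x)
    split true  x = sym (trans (+-identityʳ _) (*-identityˡ x))
    split false x = sym (trans (+-congʳ (zeroˡ x)) (+-identityˡ x))

-- The graph Laplacian and its Dirichlet form.

module Laplacian {c ℓ₁ ℓ₂} {R : RealField c ℓ₁ ℓ₂} {n : ℕ} (G : WeightedGraph R n) where
  open RealField R
  open WeightedGraph G
  open OrderedField R
  open FiniteSums R
  open IntegerCoefficients commutativeRing
  open Sum semiring using (sum-cong-≋; ∑-distrib-+; ∑-comm)
  open ≈-Reasoning setoid

  Function : Set c
  Function = Fin n → Carrier

  lap : Function → Function
  lap f i = sum λ j → weight i j * (f i - f j)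

  -- The Dirichlet form, written as a pairing with the Laplacian so that equations for `lap f` can
  -- be substituted directly.
  energy : Function → Function → Carrier
  energy f g = sum λ i → g i * lap f i

  lap-expand : ∀ f i → lap f i ≈ degree G i * f i - sum (λ j → weight i j * f j)
  lap-expand f i = begin
    sum (λ j → weight i j * (f i - f j))
      ≈⟨ sum-cong-≋ (λ j → solve 3 (λ w x y → w :* (x :- y) := x :* w :- w :* y)
          refl (weight i j) (f i) (f j)) ⟩
    sum (λ j → f i * weight i j - weight i j * f j)
      ≈⟨ sum-minus (λ j → f i * weight i j) (λ j → weight i j * f j) ⟩
    sum (λ j → f i * weight i j) - sum (λ j → weight i j * f j)
      ≈⟨ +-congʳ (trans (sum-*ˡ (f i) (weight i)) (*-comm _ _)) ⟩
    degree G i * f i - sum (λ j → weight i j * f j)          ∎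

  -- Add the double sum to its copy with `i` and `j` exchanged and use the symmetry of the weights.
  -- Symmetry and non-negativity of the form are read off the result.
  energy-dirichlet : ∀ f g →
    2# * energy f g ≈ sum λ i → sum λ j → weight i j * ((f i - f j) * (g i - g j))
  energy-dirichlet f g = begin
    2# * energy f g
      ≈⟨ solve 1 (λ e → con (+ 2) :* e := e :+ e) refl (energy f g) ⟩
    energy f g + energy f g
      ≈⟨ +-cong expand (trans expand (∑-comm term)) ⟩
    sum (λ i → sum λ j → term i j) + sum (λ i → sum λ j → term j i)
      ≈⟨ ∑-distrib-+ (λ i → sum λ j → term i j) (λ i → sum λ j → term j i) ⟨
    sum (λ i → sum (λ j → term i j) + sum (λ j → term j i))
      ≈⟨ sum-cong-≋ (λ i → trans (sym (∑-distrib-+ (λ j → term i j) (λ j → term j i)))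
          (sum-cong-≋ (combine i))) ⟩
    sum (λ i → sum λ j → weight i j * ((f i - f j) * (g i - g j))) ∎
    where
    term : Fin n → Fin n → Carrier
    term i j = g i * (weight i j * (f i - f j))
    expand : energy f g ≈ sum λ i → sum λ j → term i j
    expand = sum-cong-≋ λ i → sym (sum-*ˡ (g i) (λ j → weight i j * (f i - f j)))
    combine : ∀ i j → term i j + term j i ≈ weight i j * ((f i - f j) * (g i - g j))
    combine i j = trans (+-congˡ (*-congˡ (*-congʳ (weight-sym j i))))
      (solve 5 (λ w fi fj gi gj →
        gi :* (w :* (fi :- fj)) :+ gj :* (w :* (fj :- fi)) := w :* ((fi :- fj) :* (gi :- gj)))
        refl (weight i j) (f i) (f j) (g i) (g j))

  energy-sym : ∀ f g → energy f g ≈ energy g f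
  energy-sym f g = *-cancelˡ-≈ 0<2 (begin
    2# * energy f g                                                  ≈⟨ energy-dirichlet f g ⟩
    sum (λ i → sum λ j → weight i j * ((f i - f j) * (g i - g j)))
      ≈⟨ sum-cong-≋ {n} (λ i → sum-cong-≋ {n} λ j → *-congˡ (*-comm (f i - f j) (g i - g j))) ⟩
    sum (λ i → sum λ j → weight i j * ((g i - g j) * (f i - f j)))  ≈⟨ energy-dirichlet g f ⟨
    2# * energy g f                                                  ∎)

  dirichlet-nonneg : ∀ (f : Function) i j → 0# ≤ weight i j * ((f i - f j) * (f i - f j))
  dirichlet-nonneg f i j = *-nonneg (weight-nonneg G i j) (square-nonneg (f i - f j))

  energy-nonneg : ∀ f → 0# ≤ energy f f
  energy-nonneg f = 0≤z*x⇒0≤x 0<2 (≤-respʳ-≈ (sym (energy-dirichlet f f))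
    (sum-nonneg _ λ i → sum-nonneg _ λ j → dirichlet-nonneg f i j))

  -- Pair with the constant function 1, all of whose differences vanish.
  sum-lap : ∀ f → sum (lap f) ≈ 0#
  sum-lap f = *-cancelˡ-≈ 0<2 (begin
    2# * sum (lap f)
      ≈⟨ *-congˡ (sum-cong-≋ λ i → sym (*-identityˡ (lap f i))) ⟩
    2# * energy f (λ _ → 1#)                                           ≈⟨ energy-dirichlet f (λ _ → 1#) ⟩
    sum (λ i → sum λ j → weight i j * ((f i - f j) * (1# - 1#)))
      ≈⟨ sum-0 (λ i → sum-0 λ j → solve 2 (λ w x → w :* (x :* (con (+ 1) :- con (+ 1))) := con (+ 0))
          refl (weight i j) (f i - f j)) ⟩
    0#                                                                 ≈⟨ zeroʳ 2# ⟨
    2# * 0#                                                            ∎)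

  energy-linʳ : ∀ x y f g w → energy w (λ j → x * f j + y * g j) ≈ x * energy w f + y * energy w g
  energy-linʳ x y f g w = trans
    (sum-cong-≋ λ i → solve 5 (λ x y f g l → (x :* f :+ y :* g) :* l := x :* (f :* l)
        :+ y :* (g :* l)) refl x y (f i) (g i) (lap w i))
    (sum-lin x y (λ i → f i * lap w i) (λ i → g i * lap w i))

  energy-square : ∀ x y f g → energy (λ j → x * f j + y * g j) (λ j → x * f j + y * g j) ≈
                  x * x * energy f f + 2# * (x * y) * energy f g + y * y * energy g g
  energy-square x y f g = begin
    energy xy xy                                                       ≈⟨ energy-linʳ x y f g xy ⟩
    x * energy xy f + y * energy xy g
      ≈⟨ +-cong (*-congˡ (energy-sym xy f)) (*-congˡ (energy-sym xy g)) ⟩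
    x * energy f xy + y * energy g xy
      ≈⟨ +-cong (*-congˡ (energy-linʳ x y f g f)) (*-congˡ
          (trans (energy-linʳ x y f g g) (+-congʳ (*-congˡ (energy-sym g f))))) ⟩
    x * (x * energy f f + y * energy f g) + y * (x * energy f g + y * energy g g)
      ≈⟨ solve 5 (λ x y a b c → x :* (x :* a :+ y :* b) :+ y :* (x :* b :+ y :* c) := x :* x :* a
          :+ con (+ 2) :* (x :* y) :* b :+ y :* y :* c) refl x y (energy f f) (energy f g) (energy g g) ⟩
    x * x * energy f f + 2# * (x * y) * energy f g + y * y * energy g g ∎
    where
    xy : Function
    xy j = x * f j + y * g j

  energy-δ : ∀ f i → energy f (λ j → δ j i) ≈ lap f i
  energy-δ f i = sum-δ i (lap f)

  -- There are no loops, so the diagonal of the Laplacian is that of the degree matrix. This is what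
  -- gives the normalised Laplacian the trace `n`.
  lap-δ : ∀ i → lap (λ j → δ j i) i ≈ degree G i
  lap-δ i = begin
    lap (λ j → δ j i) i                                        ≈⟨ lap-expand (λ j → δ j i) i ⟩
    degree G i * δ i i - sum (λ j → weight i j * δ j i)
      ≈⟨ +-cong (*-congˡ (δ-diag i)) (-‿cong (trans (sum-cong-≋ λ j → *-comm (weight i j) (δ j i))
          (sum-δ i (weight i)))) ⟩
    degree G i * 1# - weight i i
      ≈⟨ +-congˡ (-‿cong (weight-0 (~-irrefl ≡.refl))) ⟩
    degree G i * 1# - 0#
      ≈⟨ solve 1 (λ k → k :* con (+ 1) :- con (+ 0) := k) refl (degree G i) ⟩
    degree G i                                                 ∎

  -- The energy is zero, so no edge can carry values apart from each other, and connectedness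
  -- spreads the equality. The pointwise hypothesis admits both harmonic functions and functions
  -- that are harmonic only away from a vertex where they vanish.
  zeroEnergy⇒constant : ∀ f → (∀ i → f i * lap f i ≈ 0#) → ∀ i j → f i ≈ f j
  zeroEnergy⇒constant f f*lap≈0 i j = walk (connected i j)
    where
    dirichlet≈0 : sum (λ i → sum λ j → weight i j * ((f i - f j) * (f i - f j))) ≈ 0#
    dirichlet≈0 = trans (sym (energy-dirichlet f f)) (trans (*-congˡ (sum-0 f*lap≈0)) (zeroʳ 2#))
    edge : ∀ {i j} → i ~ j → f i ≈ f j
    edge {i} {j} i~j = trans (solve 2 (λ x y → x := (x :- y) :+ y) refl (f i) (f j))
      (trans (+-congʳ (≈0-stable λ fi-fj#0 → <-irrefl (sym dirichlet≈0)
        (sum-pos _ (λ i → sum-nonneg _ (dirichlet-nonneg f i)) i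
          (sum-pos _ (dirichlet-nonneg f i) j (*-pos (weight-pos i~j) (square-pos fi-fj#0))))))
        (+-identityˡ (f j)))
    walk : ∀ {i j} → Star _~_ i j → f i ≈ f j
    walk ε           = refl
    walk (i~j ◅ j~*k) = trans (edge i~j) (walk j~*k)

-- The random walk: first-step analysis and stationary distribution.

module Walk {c ℓ₁ ℓ₂} {R : RealField c ℓ₁ ℓ₂} {n : ℕ} (G : WeightedGraph R n) (2≤n : 2 ℕ.≤ n) where
  open RealField R
  open WeightedGraph G
  open OrderedField R
  open FiniteSums R
  open Laplacian G
  open IntegerCoefficients commutativeRing
  open Sum semiring using (sum-cong-≋; ∑-distrib-+; ∑-comm)
  open ≈-Reasoning setoid hiding (start)

  deg : Function
  deg = degree G

  volume : Carrier
  volume = sum deg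

  P : Fin n → Fin n → Carrier
  P = transition G 2≤n

  deg-pos : ∀ i → 0# < deg i
  deg-pos = degree-pos G 2≤n

  1/deg : Function
  1/deg i = inv (deg i) (deg-pos i)

  deg*1/deg : ∀ i → deg i * 1/deg i ≈ 1#
  deg*1/deg i = trans (*-comm _ _) (inv-inverseˡ (deg i) (deg-pos i))

  deg*P : ∀ i j → deg i * P i j ≈ weight i j
  deg*P i j = trans
    (solve 3 (λ k w r → k :* (w :* r) := w :* (k :* r)) refl (deg i) (weight i j) (1/deg i))
    (trans (*-congˡ (deg*1/deg i)) (*-identityʳ _))

  lap-weightedSum : ∀ {t} (x : Fin t → Carrier) (g : Fin t → Function) i →
                    lap (λ j → sum λ s → x s * g s j) i ≈ sum λ s → x s * lap (g s) i
  lap-weightedSum x g i = begin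
    sum (λ j → weight i j * (sum (λ s → x s * g s i) - sum (λ s → x s * g s j)))
      ≈⟨ sum-cong-≋ (λ j → *-congˡ {weight i j} (sum-minus (λ s → x s * g s i) (λ s → x s * g s j))) ⟨
    sum (λ j → weight i j * sum (λ s → x s * g s i - x s * g s j))
      ≈⟨ sum-cong-≋ (λ j → sum-*ˡ (weight i j) (λ s → x s * g s i - x s * g s j)) ⟨
    sum (λ j → sum λ s → weight i j * (x s * g s i - x s * g s j))
      ≈⟨ ∑-comm (λ j s → weight i j * (x s * g s i - x s * g s j)) ⟩
    sum (λ s → sum λ j → weight i j * (x s * g s i - x s * g s j))
      ≈⟨ sum-cong-≋ (λ s → trans
           (sum-cong-≋ λ j → solve 4 (λ w x a b → w :* (x :* a :- x :* b) := x :* (w :* (a :- b)))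
             refl (weight i j) (x s) (g s i) (g s j))
           (sum-*ˡ (x s) (λ j → weight i j * (g s i - g s j)))) ⟩
    sum (λ s → x s * lap (g s) i) ∎

  -- First passage to a fixed target.

  module _ (j : Fin n) where

    -- Imposes the Dirichlet boundary condition at the target `j`.
    off : Function → Function
    off f k = if does (k ≟ᶠ j) then 0# else f k

    off-j : ∀ f → off f j ≈ 0#
    off-j f = reflexive (≡.cong (if_then 0# else f j) (dec-true (j ≟ᶠ j) ≡.refl))

    off+δ : ∀ f k → f k ≈ off f k + δ k j * f k
    off+δ f k = split (does (k ≟ᶠ j)) (f k)
      where
      split : ∀ b x → x ≈ (if b then 0# else x) + (if b then 1# else 0#) * x
      split true  x = sym (trans (+-identityˡ _) (*-identityˡ x))
      split false x = sym (trans (+-congˡ (zeroˡ x)) (+-identityʳ x))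

    -- The transition operator killed at `j`. By computation, `firstPassage` at each time from 2 on
    -- is `avoid` of its predecessor.
    avoid : Function → Function
    avoid f i = sum (off λ k → P i k * f k)

    avoid-lin : ∀ x f g i → avoid (λ k → f k + x * g k) i ≈ avoid f i + x * avoid g i
    avoid-lin x f g i = begin
      avoid (λ k → f k + x * g k) i
        ≈⟨ sum-cong-≋ (λ k → pointwise (does (k ≟ᶠ j)) (P i k) (f k) (g k)) ⟩
      sum (λ k → 1# * off (λ k → P i k * f k) k + x * off (λ k → P i k * g k) k)
        ≈⟨ sum-lin 1# x (off λ k → P i k * f k) (off λ k → P i k * g k) ⟩
      1# * avoid f i + x * avoid g i
        ≈⟨ +-congʳ (*-identityˡ _) ⟩
      avoid f i + x * avoid g i ∎
      where
      pointwise : ∀ b p y z → (if b then 0# else (p * (y + x * z))) ≈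
                  1# * (if b then 0# else (p * y)) + x * (if b then 0# else (p * z))
      pointwise true  p y z = solve 1 (λ x → con (+ 0) := con (+ 1) :* con (+ 0) :+ x :* con (+ 0)) refl x
      pointwise false p y z = solve 4 (λ x p y z → p :* (y :+ x :* z) := con (+ 1) :* (p :* y)
          :+ x :* (p :* z)) refl x p y z

    avoid-0 : ∀ {f} i → (∀ k → f k ≈ 0#) → avoid f i ≈ 0#
    avoid-0 {f} i f≈0 = sum-0 λ k → pointwise (does (k ≟ᶠ j)) (P i k) (f≈0 k)
      where
      pointwise : ∀ b p {y} → y ≈ 0# → (if b then 0# else (p * y)) ≈ 0#
      pointwise true  p y≈0 = refl
      pointwise false p y≈0 = trans (*-congˡ y≈0) (zeroʳ p)

    avoid-cong : ∀ {f g} i → (∀ k → f k ≈ g k) → avoid f i ≈ avoid g i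
    avoid-cong {f} {g} i f≈g = sum-cong-≋ λ k → pointwise (does (k ≟ᶠ j)) (P i k) (f≈g k)
      where
      pointwise : ∀ b p {y z} → y ≈ z → (if b then 0# else (p * y)) ≈ (if b then 0# else (p * z))
      pointwise true  p y≈z = refl
      pointwise false p y≈z = *-congˡ y≈z

    deg*avoid : ∀ f i → deg i * avoid f i ≈ sum (λ k → weight i k * off f k)
    deg*avoid f i = trans (sym (sum-*ˡ (deg i) (off λ k → P i k * f k)))
      (sum-cong-≋ λ k → pointwise (does (k ≟ᶠ j)) (f k) (deg*P i k))
      where
      pointwise : ∀ b y {d p w} → d * p ≈ w → d * (if b then 0# else (p * y)) ≈ w * (if b then 0# else y)
      pointwise true  y dp≈w = trans (zeroʳ _) (sym (zeroʳ _))
      pointwise false y dp≈w = trans (sym (*-assoc _ _ y)) (*-congʳ dp≈w)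

    avoid-limit : ∀ {s : ℕ → Function} {l} i → (∀ k → IsLimit (λ N → s N k) (l k)) →
                  IsLimit (λ N → avoid (s N) i) (avoid l i)
    avoid-limit {s} {l} i lim = IsLimit-sum λ k → pointwise (does (k ≟ᶠ j)) k
      where
      pointwise : ∀ b k → IsLimit (λ N → if b then 0# else (P i k * s N k)) (if b then 0# else (P i k * l k))
      pointwise true  k = IsLimit-const 0#
      -- Limits are only scaled by positive factors, so the zero transition probabilities are
      -- treated apart.
      pointwise false k with i ~? k
      ... | yes i~k = IsLimit-*ˡ (*-pos (weight-pos i~k) (inv-pos _ (deg-pos i))) (lim k)
      ... | no  i≁k = IsLimit-cong (λ N → sym (vanish (s N k)))
                        (IsLimit-congʳ (sym (vanish (l k))) (IsLimit-const 0#))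
        where
        vanish : ∀ x → P i k * x ≈ 0#
        vanish x = trans (*-congʳ (trans (*-congʳ (weight-0 i≁k)) (zeroˡ _))) (zeroˡ x)

    F : ℕ → Function
    F t i = firstPassage G 2≤n t i j

    total : ℕ → Function
    total N i = partialSum (λ t → F t i) N

    moment : ℕ → Function
    moment N i = partialSum (λ t → fromℕ t * F t i) N

    -- Either the first step lands on `j`, or passage must be completed from a neighbour with one
    -- step fewer left. The recursion starts at index 2 because the term at time 0 is zero and the
    -- one at time 1 is `P i j`.
    total-rec : ∀ N i → total (suc (suc N)) i ≈ P i j + avoid (total (suc N)) i
    total-rec zero i = begin
      0# + 0# + P i j
        ≈⟨ solve 1 (λ p → con (+ 0) :+ con (+ 0) :+ p := p :+ con (+ 0)) refl (P i j) ⟩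
      P i j + 0#                   ≈⟨ +-congˡ (avoid-0 {total 1} i (λ _ → +-identityˡ 0#)) ⟨
      P i j + avoid (total 1) i    ∎
    total-rec (suc N) i = begin
      total (2 ℕ.+ N) i + avoid (F (suc N)) i
        ≈⟨ +-congʳ (total-rec N i) ⟩
      P i j + avoid (total (suc N)) i + avoid (F (suc N)) i
        ≈⟨ solve 3 (λ p a b → p :+ a :+ b := p :+ (a :+ con (+ 1) :* b)) refl (P i j) _ _ ⟩
      P i j + (avoid (total (suc N)) i + 1# * avoid (F (suc N)) i)
        ≈⟨ +-congˡ (avoid-lin 1# (total (suc N)) (F (suc N)) i) ⟨
      P i j + avoid (λ k → total (suc N) k + 1# * F (suc N) k) i
        ≈⟨ +-congˡ (avoid-cong i λ k → +-congˡ (*-identityˡ (F (suc N) k))) ⟩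
      P i j + avoid (total (suc (suc N))) i ∎

    -- F (t + 1) = avoid (F t) for t ≥ 1, and the factor t + 1 splits as 1 + t.
    moment-rec : ∀ N i → moment (suc (suc N)) i ≈ total (suc (suc N)) i + avoid (moment (suc N)) i
    moment-rec zero i = begin
      0# + 0# * 0# + (1# + 0#) * P i j
        ≈⟨ solve 1 (λ p → con (+ 0) :+ con (+ 0) :* con (+ 0) :+ (con (+ 1) :+ con (+ 0)) :* p
            := con (+ 0) :+ con (+ 0) :+ p :+ con (+ 0)) refl (P i j) ⟩
      0# + 0# + P i j + 0#
        ≈⟨ +-congˡ (avoid-0 {moment 1} i (λ _ → trans (+-identityˡ _) (zeroˡ 0#))) ⟨
      0# + 0# + P i j + avoid (moment 1) i ∎
    moment-rec (suc N) i = begin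
      moment (2 ℕ.+ N) i + (1# + x) * f
        ≈⟨ +-congʳ (moment-rec N i) ⟩
      total (2 ℕ.+ N) i + avoid (moment (suc N)) i + (1# + x) * f
        ≈⟨ solve 4 (λ t a x f → t :+ a :+ (con (+ 1) :+ x) :* f := t :+ f :+ (a :+ x :* f))
            refl (total (2 ℕ.+ N) i) _ x f ⟩
      total (2 ℕ.+ N) i + f + (avoid (moment (suc N)) i + x * f)
        ≈⟨ +-congˡ (avoid-lin x (moment (suc N)) (F (suc N)) i) ⟨
      total (3 ℕ.+ N) i + avoid (moment (2 ℕ.+ N)) i ∎
      where
      x = fromℕ (suc N)
      f = avoid (F (suc N)) i

    module _ (m : Function) (mean : ∀ i → HasSum (λ t → fromℕ t * F t i) (m i)) where

      -- The probability of ever reaching `j` from `i`, expressed through the means. Convergence of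
      -- the total probability is not a hypothesis, so it has to come from convergence of the first
      -- moments.
      return : Function
      return i = m i - avoid m i

      -- Solve `moment-rec` for `total` and pass to the limit in the two moments.
      total-limit : ∀ i → IsLimit (λ N → total (suc (suc N)) i) (return i)
      total-limit i = IsLimit-cong
        (λ N → trans (+-congʳ (moment-rec N i)) (solve 2 (λ t a → t :+ a :- a := t) refl _ _))
        -- The recursion relates index `N + 2` to index `N + 1`, hence two shifts here and one
        -- inside `avoid`.
        (IsLimit-+ (IsLimit-suc (IsLimit-suc (mean i)))
                   (IsLimit-neg (avoid-limit i λ k → IsLimit-suc (mean k))))

      return-rec : ∀ i → return i ≈ P i j + avoid return i
      return-rec i = IsLimit-unique (IsLimit-suc (total-limit i))
        (IsLimit-cong (λ N → sym (total-rec (suc N) i))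
          (IsLimit-+ (IsLimit-const (P i j)) (avoid-limit i total-limit)))

      defect : Function
      defect = off λ k → return k - 1#

      -- The constant 1 satisfies the same recursion as `return`, because transition probabilities
      -- sum to one. The difference therefore satisfies the homogeneous one.
      deg*defect : ∀ i → deg i * (return i - 1#) ≈ sum λ k → weight i k * defect k
      deg*defect i = begin
        deg i * (return i - 1#)
          ≈⟨ solve 2 (λ d b → d :* (b :- con (+ 1)) := d :* b :- d) refl (deg i) (return i) ⟩
        deg i * return i - deg i
          -- The degree is split into the weight towards `j` and the rest, so that the two copies of
          -- `weight i j` cancel.
          ≈⟨ +-cong (trans (*-congˡ (return-rec i)) (distribˡ _ _ _)) (-‿cong (sum-split j (weight i))) ⟩
        deg i * P i j + deg i * avoid return i - (weight i j + sum (off (weight i)))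
          ≈⟨ +-congʳ (+-cong (deg*P i j) (deg*avoid return i)) ⟩
        weight i j + sum (λ k → weight i k * off return k) - (weight i j + sum (off (weight i)))
          ≈⟨ solve 3 (λ w a b → w :+ a :- (w :+ b) := a :- b) refl (weight i j) _ _ ⟩
        sum (λ k → weight i k * off return k) - sum (off (weight i))
          ≈⟨ sum-minus (λ k → weight i k * off return k) (off (weight i)) ⟨
        sum (λ k → weight i k * off return k - off (weight i) k)
          ≈⟨ sum-cong-≋ (λ k → pointwise (does (k ≟ᶠ j)) (weight i k) (return k)) ⟩
        sum (λ k → weight i k * defect k) ∎
        where
        pointwise : ∀ b w y → w * (if b then 0# else y) - (if b then 0# else w) ≈
                              w * (if b then 0# else (y - 1#))
        pointwise true  w y = solve 1 (λ w → w :* con (+ 0) :- con (+ 0) := w :* con (+ 0)) refl w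
        pointwise false w y = solve 2 (λ w y → w :* y :- w := w :* (y :- con (+ 1))) refl w y

      -- The defect is harmonic away from `j` and vanishes at `j`, so it is constant with value
      -- zero. This is recurrence: the walk reaches `j` almost surely.
      defect≈0 : ∀ i → defect i ≈ 0#
      defect≈0 i = trans (zeroEnergy⇒constant defect harmonic i j) (off-j (λ k → return k - 1#))
        where
        pointwise : ∀ b d y → (if b then 0# else y) * (d * (if b then 0# else y) - d * y) ≈ 0#
        pointwise true  d y = zeroˡ _
        pointwise false d y = solve 2 (λ d y → y :* (d :* y :- d :* y) := con (+ 0)) refl d y
        harmonic : ∀ i → defect i * lap defect i ≈ 0#
        harmonic i = trans
          (*-congˡ (trans (lap-expand defect i) (+-congˡ (-‿cong (sym (deg*defect i))))))
          (pointwise (does (i ≟ᶠ j)) (deg i) (return i - 1#))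

      return≈1 : ∀ i → return i ≈ 1#
      return≈1 i = begin
        return i             ≈⟨ solve 1 (λ b → b := b :- con (+ 1) :+ con (+ 1)) refl (return i) ⟩
        return i - 1# + 1#   ≈⟨ +-congʳ (*-cancelˡ-≈ (deg-pos i) (trans (deg*defect i)
                                 (trans (sum-0 λ k → trans (*-congˡ (defect≈0 k)) (zeroʳ _)) (sym (zeroʳ _))))) ⟩
        0# + 1#              ≈⟨ +-identityˡ 1# ⟩
        1#                   ∎

      deg*mean : ∀ i → deg i * m i ≈ deg i + sum (λ k → weight i k * off m k)
      deg*mean i = begin
        deg i * m i
          ≈⟨ *-congˡ (solve 2 (λ x a → x := x :- a :+ a) refl (m i) (avoid m i)) ⟩
        deg i * (return i + avoid m i)                ≈⟨ distribˡ _ _ _ ⟩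
        deg i * return i + deg i * avoid m i
          ≈⟨ +-cong (trans (*-congˡ (return≈1 i)) (*-identityʳ _)) (deg*avoid m i) ⟩
        deg i + sum (λ k → weight i k * off m k)     ∎

      -- Away from `j` this is the first-step equation for hitting times. The correction at `j`
      -- arises because `off m` is zero there while the first-step equation produces the mean return
      -- time.
      lap-off : ∀ i → lap (off m) i ≈ deg i - δ i j * (deg i * m i)
      lap-off i = begin
        lap (off m) i
          ≈⟨ lap-expand (off m) i ⟩
        deg i * off m i - sum (λ k → weight i k * off m k)
          ≈⟨ solve 3 (λ d h s → d :* h :- s := d :* h :- (d :+ s) :+ d) refl (deg i) (off m i) _ ⟩
        deg i * off m i - (deg i + sum (λ k → weight i k * off m k)) + deg i
          ≈⟨ +-congʳ (+-congˡ (-‿cong (trans (sym (deg*mean i)) (*-congˡ (off+δ m i))))) ⟩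
        deg i * off m i - deg i * (off m i + δ i j * m i) + deg i
          ≈⟨ solve 4 (λ d h e m → d :* h :- d :* (h :+ e :* m) :+ d := d :- e :* (d :* m))
              refl (deg i) (off m i) (δ i j) (m i) ⟩
        deg i - δ i j * (deg i * m i) ∎

      -- Kac's formula for the mean return time. A Laplacian sums to zero, so summing `lap-off` over
      -- all vertices isolates the correction at `j`.
      deg*meanReturn : deg j * m j ≈ volume
      deg*meanReturn = begin
        deg j * m j                                                  ≈⟨ sum-δ j (λ i → deg i * m i) ⟨
        sum (λ i → δ i j * (deg i * m i))
          ≈⟨ solve 2 (λ v s → s := v :- (v :- s)) refl volume _ ⟩
        volume - (volume - sum (λ i → δ i j * (deg i * m i)))
          ≈⟨ +-congˡ (-‿cong (trans (sym (trans (sum-cong-≋ lap-off) (sum-minus deg _))) (sum-lap (off m)))) ⟩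
        volume - 0#                                                  ≈⟨ x-0≈x volume ⟩
        volume                                                       ∎

      δ-return : ∀ i → δ i j * (deg i * m i) ≈ δ i j * volume
      δ-return i with i ≟ᶠ j
      ... | yes ≡.refl = *-congˡ deg*meanReturn
      ... | no  _      = trans (zeroˡ _) (sym (zeroˡ _))

  -- Invariance says that the density `π / deg` is harmonic, hence constant; the total mass 1 fixes
  -- the constant.
  stationary : ∀ {π} → IsStationary G 2≤n π → ∀ i → volume * π i ≈ deg i
  stationary {π} isStationary i = begin
    volume * π i                 ≈⟨ *-congˡ (π≈ i) ⟨
    volume * (deg i * g i)
      ≈⟨ solve 3 (λ v d g → v :* (d :* g) := d :* (g :* v)) refl volume (deg i) (g i) ⟩
    deg i * (g i * volume)
      ≈⟨ *-congˡ (trans (sym (sum-*ˡ (g i) deg)) (sum-cong-≋ λ k → trans (*-comm (g i) (deg k))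
          (trans (*-congˡ (constant i k)) (π≈ k)))) ⟩
    deg i * sum π                ≈⟨ trans (*-congˡ (IsStationary.total isStationary)) (*-identityʳ _) ⟩
    deg i                        ∎
    where
    g : Function
    g k = π k * 1/deg k
    π≈ : ∀ k → deg k * g k ≈ π k
    π≈ k = trans (solve 3 (λ d p r → d :* (p :* r) := p :* (d :* r)) refl (deg k) (π k) (1/deg k))
                 (trans (*-congˡ (deg*1/deg k)) (*-identityʳ _))
    flow : ∀ j → sum (λ k → weight j k * g k) ≈ π j
    flow j = trans
      (sum-cong-≋ λ k → trans (*-congʳ (weight-sym j k))
        (solve 3 (λ w p r → w :* (p :* r) := p :* (w :* r)) refl (weight k j) (π k) (1/deg k)))
      (IsStationary.invariant isStationary j)
    constant : ∀ i k → g i ≈ g k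
    constant = zeroEnergy⇒constant g λ j → trans
      (*-congˡ (trans (lap-expand g j) (trans (+-cong (π≈ j) (-‿cong (flow j))) (-‿inverseʳ (π j)))))
      (zeroʳ _)

  -- Kemeny's constant as the total energy of the hitting times.

  module Kemeny {K : Carrier} (isKemeny : IsKemenyConstant G 2≤n K) where
    open IsKemenyConstant isKemeny

    hitting : Fin n → Function
    hitting t = off t λ s → m s t

    hitting-diag : ∀ t → hitting t t ≈ 0#
    hitting-diag t = off-j t λ s → m s t

    lap-hitting : ∀ t s → lap (hitting t) s ≈ deg s - δ s t * volume
    lap-hitting t s = trans (lap-off t (λ s → m s t) (λ s → isMeanPassage s t) s)
      (+-congˡ (-‿cong (δ-return t (λ s → m s t) (λ s → isMeanPassage s t) s)))

    δ-sym : ∀ (s t : Fin n) → δ s t ≈ δ t s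
    δ-sym s t with s ≟ᶠ t
    ... | yes ≡.refl = sym (δ-diag s)
    ... | no  s≢t    with t ≟ᶠ s
    ...   | yes t≡s = contradiction (≡.sym t≡s) s≢t
    ...   | no  _   = refl

    weightedHitting : Function
    weightedHitting s = sum λ t → deg t * hitting t s

    -- The mean passage time differs from the hitting time only at the target `start`. By Kac's
    -- formula that one term contributes `volume`, which is exactly the `- 1#` in the definition of
    -- the constant.
    weightedHitting-start : weightedHitting start ≈ volume * K
    weightedHitting-start = sym (begin
      volume * K
        ≈⟨ *-congˡ value ⟩
      volume * (sum (λ t → π t * m start t) - 1#)
        ≈⟨ solve 2 (λ v s → v :* (s :- con (+ 1)) := v :* s :- v) refl volume _ ⟩
      volume * sum (λ t → π t * m start t) - volume
        ≈⟨ +-congʳ (trans (sym (sum-*ˡ volume (λ t → π t * m start t))) (sum-cong-≋ split)) ⟩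
      sum (λ t → deg t * hitting t start + δ t start * (deg t * m start t)) - volume
        ≈⟨ +-congʳ (∑-distrib-+ (λ t → deg t * hitting t start) (λ t → δ t start * (deg t * m start t))) ⟩
      weightedHitting start + sum (λ t → δ t start * (deg t * m start t)) - volume
        ≈⟨ +-congʳ (+-congˡ (trans (sum-δ start (λ t → deg t * m start t))
             (deg*meanReturn start (λ s → m s start) (λ s → isMeanPassage s start)))) ⟩
      weightedHitting start + volume - volume
        ≈⟨ solve 2 (λ w v → w :+ v :- v := w) refl (weightedHitting start) volume ⟩
      weightedHitting start ∎)
      where
      split : ∀ t → volume * (π t * m start t) ≈ deg t * hitting t start + δ t start * (deg t * m start t)
      split t = begin
        volume * (π t * m start t)                                  ≈⟨ *-assoc _ _ _ ⟨
        volume * π t * m start t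
          ≈⟨ *-cong (stationary isStationary t) (off+δ t (λ s → m s t) start) ⟩
        deg t * (hitting t start + δ start t * m start t)
          ≈⟨ *-congˡ (+-congˡ (*-congʳ (δ-sym start t))) ⟩
        deg t * (hitting t start + δ t start * m start t)
          ≈⟨ solve 4 (λ d h e m → d :* (h :+ e :* m) := d :* h :+ e :* (d :* m))
              refl (deg t) (hitting t start) (δ t start) (m start t) ⟩
        deg t * hitting t start + δ t start * (deg t * m start t)   ∎

    lap-weightedHitting : ∀ s → lap weightedHitting s ≈ 0#
    lap-weightedHitting s = begin
      lap weightedHitting s                              ≈⟨ lap-weightedSum deg hitting s ⟩
      sum (λ t → deg t * lap (hitting t) s)
        ≈⟨ sum-cong-≋ (λ t → trans
             (*-congˡ (trans (lap-hitting t s) (+-congˡ (-‿cong (*-congʳ (δ-sym s t))))))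
             (solve 4 (λ d e x v → d :* (e :- x :* v) := e :* d :+ (:- v) :* (x :* d))
               refl (deg t) (deg s) (δ t s) volume)) ⟩
      sum (λ t → deg s * deg t + - volume * (δ t s * deg t))
        ≈⟨ sum-lin (deg s) (- volume) deg (λ t → δ t s * deg t) ⟩
      deg s * volume + - volume * sum (λ t → δ t s * deg t)  ≈⟨ +-congˡ (*-congˡ (sum-δ s deg)) ⟩
      deg s * volume + - volume * deg s
        ≈⟨ solve 2 (λ d v → d :* v :+ (:- v) :* d := con (+ 0)) refl (deg s) volume ⟩
      0#                                                 ∎

    -- The random target identity: harmonicity carries the value at `start` to every vertex.
    weightedHitting≈ : ∀ s → weightedHitting s ≈ volume * K
    weightedHitting≈ s = trans
      (zeroEnergy⇒constant weightedHitting (λ i → trans (*-congˡ (lap-weightedHitting i)) (zeroʳ _)) s start)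
      weightedHitting-start

    -- Up to the factor `- volume`, hitting times represent point evaluation on functions of
    -- weighted mean zero.
    energy-hitting : ∀ t f → energy (hitting t) f ≈ sum (λ s → deg s * f s) - volume * f t
    energy-hitting t f = begin
      energy (hitting t) f
        ≈⟨ sum-cong-≋ (λ s → trans (*-congˡ (lap-hitting t s))
             (solve 4 (λ f d e v → f :* (d :- e :* v) := con (+ 1) :* (d :* f) :+ (:- v) :* (e :* f))
               refl (f s) (deg s) (δ s t) volume)) ⟩
      sum (λ s → 1# * (deg s * f s) + - volume * (δ s t * f s))
        ≈⟨ sum-lin 1# (- volume) (λ s → deg s * f s) (λ s → δ s t * f s) ⟩
      1# * sum (λ s → deg s * f s) + - volume * sum (λ s → δ s t * f s) ≈⟨ +-congˡ (*-congˡ (sum-δ t f)) ⟩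
      1# * sum (λ s → deg s * f s) + - volume * f t
        ≈⟨ solve 3 (λ s v f → con (+ 1) :* s :+ (:- v) :* f := s :- v :* f) refl _ volume (f t) ⟩
      sum (λ s → deg s * f s) - volume * f t                       ∎

    -- Since `hitting t` vanishes at `t`, its energy is its weighted sum over starting points.
    -- Summing over targets first leaves the constant `weightedHitting`.
    totalEnergy : sum (λ t → deg t * energy (hitting t) (hitting t)) ≈ volume * (volume * K)
    totalEnergy = begin
      sum (λ t → deg t * energy (hitting t) (hitting t))
        ≈⟨ sum-cong-≋ (λ t → *-congˡ (trans (energy-hitting t (hitting t))
             (trans (+-congˡ (-‿cong (trans (*-congˡ (hitting-diag t)) (zeroʳ volume)))) (x-0≈x _)))) ⟩
      sum (λ t → deg t * sum (λ s → deg s * hitting t s))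
        ≈⟨ sum-cong-≋ (λ t → trans (sym (sum-*ˡ (deg t) (λ s → deg s * hitting t s)))
             (sum-cong-≋ λ s → solve 3 (λ a b h → a :* (b :* h) := b :* (a :* h))
                 refl (deg t) (deg s) (hitting t s))) ⟩
      sum (λ t → sum λ s → deg s * (deg t * hitting t s))
        ≈⟨ ∑-comm (λ t s → deg s * (deg t * hitting t s)) ⟩
      sum (λ s → sum λ t → deg s * (deg t * hitting t s))
        ≈⟨ sum-cong-≋ (λ s → trans (sum-*ˡ (deg s) (λ t → deg t * hitting t s))
             (trans (*-congˡ (weightedHitting≈ s)) (*-comm (deg s) (volume * K)))) ⟩
      sum (λ s → volume * K * deg s)
        ≈⟨ sum-*ˡ (volume * K) deg ⟩
      volume * K * volume
        ≈⟨ *-comm _ _ ⟩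
      volume * (volume * K) ∎

-- The variational lower bound.

module Bound {ℓ₀ ℓ₁ ℓ₂} {R : RealField ℓ₀ ℓ₁ ℓ₂} {n : ℕ} (G : WeightedGraph R n) (2≤n : 2 ℕ.≤ n)
             {K : RealField.Carrier R} (isKemeny : IsKemenyConstant G 2≤n K) where
  open RealField R
  open WeightedGraph G
  open OrderedField R
  open FiniteSums R
  open Laplacian G
  open Walk G 2≤n
  open Kemeny isKemeny
  open IntegerCoefficients commutativeRing
  open Sum semiring using (sum-cong-≋; ∑-distrib-+)
  open ≈-Reasoning setoid

  -- The weighted energy ∑ deg t · E(f_t, f_t) is non-negative for the family
  -- f_t = x h_t + y u(t) u + (z / deg t) δ_t.
  variational : ∀ u → sum (λ i → deg i * u i) ≈ 0# → ∀ x y z →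
    0# ≤ x * x * (volume * (volume * K))
       + (y * y * energy u u - 2# * x * y * volume) * sum (λ i → deg i * (u i * u i))
       + 2# * x * z * volume + 2# * y * z * energy u u
       + fromℕ n * (z * z - 2# * x * z * volume)
  variational u u⊥1 x y z = ≤-respʳ-≈ total≈
      (sum-nonneg _ λ t → *-nonneg (<⇒≤ (deg-pos t)) (energy-nonneg (trial t)))
    where
    X = energy u u
    e₁ e₂ : Carrier
    e₁ = y * y * X - 2# * x * y * volume
    e₂ = z * z - 2# * x * z * volume
    δ· : Fin n → Function
    δ· t s = δ s t
    g trial : Fin n → Function
    -- The factor `u t` makes the pairing of `u` with `hitting t` a multiple of `u t * u t`. A point
    -- mass has energy `deg t`, so with the scale `1/deg t` its own energy, weighted by `deg t`, is
    -- `z * z` at every vertex.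
    g t s = (y * u t) * u s + (z * 1/deg t) * δ· t s
    trial t s = x * hitting t s + 1# * g t s
    energy-g : ∀ t → energy (g t) (g t) ≈
      y * u t * (y * u t) * X + 2# * (y * u t * (z * 1/deg t)) * lap u t
      + z * 1/deg t * (z * 1/deg t) * deg t
    energy-g t = trans (energy-square (y * u t) (z * 1/deg t) u (δ· t))
      (+-cong (+-congˡ (*-congˡ (energy-δ u t))) (*-congˡ (trans (energy-δ (δ· t) t) (lap-δ t))))
    energy-h-g : ∀ t → energy (hitting t) (g t) ≈
      y * u t * (0# - volume * u t) + z * 1/deg t * (deg t - 1# * volume)
    energy-h-g t = trans (energy-linʳ (y * u t) (z * 1/deg t) u (δ· t) (hitting t))
      (+-cong (*-congˡ (trans (energy-hitting t u) (+-congʳ u⊥1)))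
              (*-congˡ (trans (energy-δ (hitting t) t)
                (trans (lap-hitting t t) (+-congˡ (-‿cong (*-congʳ (δ-diag t))))))))
    summand : ∀ t → deg t * energy (trial t) (trial t) ≈
      x * x * (deg t * energy (hitting t) (hitting t)) + e₁ * (deg t * (u t * u t))
      + (2# * x * z * deg t + 2# * y * z * (u t * lap u t)) + e₂
    summand t = begin
      deg t * energy (trial t) (trial t)
        ≈⟨ *-congˡ (trans (energy-square x 1# (hitting t) (g t))
             (+-cong (+-congˡ (*-congˡ (energy-h-g t))) (*-congˡ (energy-g t)))) ⟩
      d * (x * x * h + 2# * (x * 1#) * (y * u t * (0# - volume * u t) + z * r * (d - 1# * volume))
           + 1# * 1# * (y * u t * (y * u t) * X + 2# * (y * u t * (z * r)) * l + z * r * (z * r) * d))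
        -- To the solver `r` is a free variable, so each product `d * r` is kept together for the
        -- next step to replace by `1#`.
        ≈⟨ solve 10 (λ d x h y u v z r X l →
             d :* (x :* x :* h :+ con (+ 2) :* (x :* con (+ 1)) :* (y :* u :* (con (+ 0) :- v :* u)
                 :+ z :* r :* (d :- con (+ 1) :* v))
               :+ con (+ 1) :* con (+ 1) :* (y :* u :* (y :* u) :* X
                   :+ con (+ 2) :* (y :* u :* (z :* r)) :* l :+ z :* r :* (z :* r) :* d))
             := x :* x :* (d :* h) :+ (y :* y :* X :- con (+ 2) :* x :* y :* v) :* (d :* (u :* u))
                :+ d :* r :* (con (+ 2) :* x :* z :* d :+ con (+ 2) :* y :* z :* (u :* l))
                :+ (z :* z :* (d :* r) :- con (+ 2) :* x :* z :* v) :* (d :* r))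
             refl d x h y (u t) volume z r X l ⟩
      x * x * (d * h) + e₁ * (d * (u t * u t)) + d * r * (2# * x * z * d + 2# * y * z * (u t * l))
        + (z * z * (d * r) - 2# * x * z * volume) * (d * r)
        ≈⟨ +-cong (+-congˡ (trans (*-congʳ (deg*1/deg t)) (*-identityˡ _)))
             (trans (*-cong (+-congʳ (trans (*-congˡ (deg*1/deg t)) (*-identityʳ _))) (deg*1/deg t)) (*-identityʳ _)) ⟩
      x * x * (d * h) + e₁ * (d * (u t * u t)) + (2# * x * z * d + 2# * y * z * (u t * l)) + e₂ ∎
      where
      d = deg t
      h = energy (hitting t) (hitting t)
      r = 1/deg t
      l = lap u t
    total≈ : sum (λ t → deg t * energy (trial t) (trial t)) ≈ _
    total≈ = begin
      sum (λ t → deg t * energy (trial t) (trial t))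
        ≈⟨ sum-cong-≋ summand ⟩
      sum (λ t → A t + B t + e₂)
        ≈⟨ ∑-distrib-+ (λ t → A t + B t) (λ _ → e₂) ⟩
      sum (λ t → A t + B t) + sum {n} (λ _ → e₂)
        ≈⟨ +-cong (∑-distrib-+ A B) (sum-const {n} e₂) ⟩
      sum A + sum B + fromℕ n * e₂
        ≈⟨ +-congʳ (+-cong
             (trans (sum-lin (x * x) e₁ (λ t → deg t * energy (hitting t) (hitting t))
                 (λ t → deg t * (u t * u t)))
               (+-congʳ (*-congˡ totalEnergy)))
             (sum-lin (2# * x * z) (2# * y * z) deg (λ t → u t * lap u t))) ⟩
      x * x * (volume * (volume * K)) + e₁ * sum (λ i → deg i * (u i * u i))
        + (2# * x * z * volume + 2# * y * z * X) + fromℕ n * e₂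
        ≈⟨ +-congʳ (sym (+-assoc _ _ _)) ⟩
      _ ∎
      where
      A B : Fin n → Carrier
      A t = x * x * (deg t * energy (hitting t) (hitting t)) + e₁ * (deg t * (u t * u t))
      B t = 2# * x * z * deg t + 2# * y * z * (u t * lap u t)

  -- The centred indicator of a vertex set.

  module _ (S : Subset n) where

    indicator : Function
    indicator i = if lookup S i then 1# else 0#

    sumOver-indicator : ∀ f → sumOver G S f ≈ sum (λ i → f i * indicator i)
    sumOver-indicator f = sum-cong-≋ λ i → pointwise (lookup S i) (f i)
      where
      pointwise : ∀ b x → (if b then x else 0#) ≈ x * (if b then 1# else 0#)
      pointwise true  x = sym (*-identityʳ x)
      pointwise false x = sym (zeroʳ x)

    sumOver-∁ : ∀ f → sumOver G (∁ S) f ≈ sum (λ i → f i * (1# - indicator i))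
    sumOver-∁ f = sum-cong-≋ λ i → trans
      (reflexive (≡.cong (if_then f i else 0#) (lookup-map i not S)))
      (pointwise (lookup S i) (f i))
      where
      pointwise : ∀ b x → (if not b then x else 0#) ≈ x * (1# - (if b then 1# else 0#))
      pointwise true  x = solve 1 (λ x → con (+ 0) := x :* (con (+ 1) :- con (+ 1))) refl x
      pointwise false x = solve 1 (λ x → x := x :* (con (+ 1) :- con (+ 0))) refl x

    indicator-idem : ∀ i → indicator i * indicator i ≈ indicator i
    indicator-idem i = pointwise (lookup S i)
      where
      pointwise : ∀ b → (if b then 1# else 0#) * (if b then 1# else 0#) ≈ (if b then 1# else 0#)
      pointwise true  = *-identityˡ 1#
      pointwise false = zeroˡ 0#

    vol+vol∁ : vol G S + vol G (∁ S) ≈ volume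
    vol+vol∁ = begin
      vol G S + vol G (∁ S)
        ≈⟨ +-cong (sumOver-indicator deg) (sumOver-∁ deg) ⟩
      sum (λ i → deg i * indicator i) + sum (λ i → deg i * (1# - indicator i))
        ≈⟨ ∑-distrib-+ (λ i → deg i * indicator i) _ ⟨
      sum (λ i → deg i * indicator i + deg i * (1# - indicator i))
        ≈⟨ sum-cong-≋ (λ i → solve 2 (λ d s → d :* s :+ d :* (con (+ 1) :- s) := d)
            refl (deg i) (indicator i)) ⟩
      volume                                                                       ∎

    energy-indicator : energy indicator indicator ≈ cutWeight G S
    energy-indicator = sum-cong-≋ λ i → pointwise i (lookup S i) ≡.refl
      where
      pointwise : ∀ i b → lookup S i ≡ b →
                  indicator i * lap indicator i ≈ (if b then sumOver G (∁ S) (weight i) else 0#)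
      -- After the rewrite `indicator i` is `1#`, so the Laplacian at `i` already sums the weights
      -- against the indicator of the complement.
      pointwise i true  i∈S rewrite i∈S = trans (*-identityˡ _) (sym (sumOver-∁ (weight i)))
      pointwise i false i∉S rewrite i∉S = zeroˡ _

    -- The indicator minus its weighted mean, multiplied by `volume` to avoid division. The trailing
    -- `* 1#` gives it the shape that `energy-square` expects.
    centred : Function
    centred i = volume * indicator i + - vol G S * 1#

    centred-⊥ : sum (λ i → deg i * centred i) ≈ 0#
    centred-⊥ = begin
      sum (λ i → deg i * centred i)
        ≈⟨ sum-cong-≋ (λ i → solve 4 (λ d v s a → d :* (v :* s :+ (:- a) :* con (+ 1))
            := v :* (d :* s) :+ (:- a) :* d) refl (deg i) volume (indicator i) (vol G S)) ⟩
      sum (λ i → volume * (deg i * indicator i) + - vol G S * deg i)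
        ≈⟨ sum-lin volume (- vol G S) (λ i → deg i * indicator i) deg ⟩
      volume * sum (λ i → deg i * indicator i) + - vol G S * volume
        ≈⟨ +-congʳ (*-congˡ (sumOver-indicator deg)) ⟨
      volume * vol G S + - vol G S * volume
        ≈⟨ solve 2 (λ v a → v :* a :+ (:- a) :* v := con (+ 0)) refl volume (vol G S) ⟩
      0# ∎

    -- Idempotence makes the square of the centred indicator linear in the indicator, so only
    -- `vol G S` and `volume` enter.
    centred-norm : sum (λ i → deg i * (centred i * centred i)) ≈ volume * (vol G S * vol G (∁ S))
    centred-norm = begin
      sum (λ i → deg i * (centred i * centred i))
        ≈⟨ sum-cong-≋ (λ i → trans
             (solve 4 (λ d v s a → d :* ((v :* s :+ (:- a) :* con (+ 1)) :* (v :* s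
                 :+ (:- a) :* con (+ 1))) :=
                v :* v :* (d :* (s :* s)) :- con (+ 2) :* v :* a :* (d :* s) :+ a :* a :* d)
                    refl (deg i) volume (indicator i) a)
             (trans (+-congʳ (+-congʳ (*-congˡ (*-congˡ (indicator-idem i)))))
                (solve 4 (λ d v s a → v :* v :* (d :* s) :- con (+ 2) :* v :* a :* (d :* s) :+ a :* a :* d :=
                  (v :* v :- con (+ 2) :* v :* a) :* (d :* s) :+ a :* a :* d)
                      refl (deg i) volume (indicator i) a))) ⟩
      sum (λ i → (volume * volume - 2# * volume * a) * (deg i * indicator i) + a * a * deg i)
        ≈⟨ sum-lin (volume * volume - 2# * volume * a) (a * a) (λ i → deg i * indicator i) deg ⟩
      (volume * volume - 2# * volume * a) * sum (λ i → deg i * indicator i) + a * a * volume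
        ≈⟨ +-congʳ (*-congˡ (sumOver-indicator deg)) ⟨
      (volume * volume - 2# * volume * a) * a + a * a * volume
        ≈⟨ solve 2 (λ v a → (v :* v :- con (+ 2) :* v :* a) :* a :+ a :* a :* v
            := v :* (a :* (v :- a))) refl volume a ⟩
      volume * (a * (volume - a))
        ≈⟨ *-congˡ (*-congˡ (trans (+-congʳ (sym vol+vol∁)) (solve 2 (λ a b → a :+ b :- a := b)
            refl a (vol G (∁ S))))) ⟩
      volume * (a * vol G (∁ S)) ∎
      where a = vol G S

    energy-centred : energy centred centred ≈ volume * volume * cutWeight G S
    energy-centred = begin
      energy centred centred
        ≈⟨ energy-square volume (- vol G S) indicator (λ _ → 1#) ⟩
      volume * volume * energy indicator indicator + 2# * (volume * - vol G S) * energy indicator (λ _ → 1#)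
        + - vol G S * - vol G S * energy (λ _ → 1#) (λ _ → 1#)
        ≈⟨ +-cong (+-cong (*-congˡ energy-indicator) (*-congˡ (energy-1 indicator))) (*-congˡ (energy-1
            (λ _ → 1#))) ⟩
      volume * volume * cutWeight G S + 2# * (volume * - vol G S) * 0# + - vol G S * - vol G S * 0#
        ≈⟨ solve 3 (λ v a x → v :* v :* x :+ con (+ 2) :* (v :* :- a) :* con (+ 0)
            :+ :- a :* :- a :* con (+ 0) := v :* v :* x) refl volume (vol G S) (cutWeight G S) ⟩
      volume * volume * cutWeight G S ∎
      where
      energy-1 : ∀ f → energy f (λ _ → 1#) ≈ 0#
      energy-1 f = trans (sum-cong-≋ λ i → *-identityˡ (lap f i)) (sum-lap f)

  fromℕ-2 : Carrier
  fromℕ-2 = fromℕ n - fromℕ 2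

  0<n : 0# < fromℕ n
  0<n = fromℕ-pos (ℕₚ.<⇒≤ 2≤n)

  module _ (C : Cut n) where
    private
      S = proj₁ C
      c a b p v N d : Carrier
      c = cutWeight G S
      a = vol G S
      b = vol G (∁ S)
      p = a * b
      v = volume
      N = fromℕ n
      d = fromℕ-2

    0<a : 0# < a
    0<a = vol-pos G 2≤n S (proj₁ (proj₂ C))

    0<b : 0# < b
    0<b with proj₂ (proj₂ C)
    ... | _ , w , _ , w∉S = vol-pos G 2≤n (∁ S) (w , x∉p⇒x∈∁p w∉S)

    0<p : 0# < p
    0<p = *-pos 0<a 0<b

    0<v : 0# < v
    0<v = <-respʳ-≈ (vol+vol∁ S) (0<+0≤ 0<a (<⇒≤ 0<b))

    0<c : 0# < c
    0<c = cutWeight-pos G C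

    -- Put μ = c v / p, σ = z / x and τ = (v p y + z) / x.  Divided by x², the
    -- variational inequality reads 0 ≤ v² K - 2 v (τ + d σ) + μ τ² + (N - μ) σ².  It is
    -- used at τ = v / μ and σ = v d / N; x = N c v p clears the denominators.
    variational-cut :
      0# ≤ N * N * c * v * p * K - N * N * p * p - d * d * N * c * v * p - v * v * c * c * d * d
    variational-cut = 0≤z*x⇒0≤x (*-pos (*-pos 0<c 0<p) (*-pos 0<v (*-pos 0<v 0<v)))
      (≤-respʳ-≈ (begin
        x * x * (v * (v * K))
          + (y * y * energy u u - 2# * x * y * v) * sum (λ i → deg i * (u i * u i))
          + 2# * x * z * v + 2# * y * z * energy u u + N * (z * z - 2# * x * z * v)
          ≈⟨ +-congʳ (+-cong (+-congʳ (+-congˡ (*-cong (+-congʳ (*-congˡ (energy-centred S))) (centred-norm S))))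
               (*-congˡ (energy-centred S))) ⟩
        x * x * (v * (v * K))
          + (y * y * (v * v * c) - 2# * x * y * v) * (v * p)
          + 2# * x * z * v + 2# * y * z * (v * v * c) + N * (z * z - 2# * x * z * v)
          ≈⟨ solve 5 (λ N c v p K →
               -- Here `d` must be unfolded: the terms linear in `z` combine as required only for
               -- `d = N - 2`.
               let d = N :- (con (+ 1) :+ (con (+ 1) :+ con (+ 0)))
                   x = N :* c :* v :* p
                   y = N :* p :- c :* v :* d
                   z = c :* v :* v :* p :* d
               in x :* x :* (v :* (v :* K))
                  :+ (y :* y :* (v :* v :* c) :- con (+ 2) :* x :* y :* v) :* (v :* p)
                  :+ con (+ 2) :* x :* z :* v :+ con (+ 2) :* y :* z :* (v :* v :* c)
                      :+ N :* (z :* z :- con (+ 2) :* x :* z :* v)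
                  := c :* p :* (v :* (v :* v)) :*
                     (N :* N :* c :* v :* p :* K :- N :* N :* p :* p :- d :* d :* N :* c :* v :* p :- v :* v :* c :* c :* d :* d))
               refl N c v p K ⟩
        c * p * (v * (v * v)) * (N * N * c * v * p * K - N * N * p * p - d * d * N * c * v * p - v * v * c * c * d * d) ∎)
        (variational u (centred-⊥ S) x y z))
      where
      x y z : Carrier
      x = N * c * v * p
      y = N * p - c * v * d
      z = c * v * v * p * d
      u : Function
      u = centred S

  -- The part of `K` that must exceed `1 / (2 φ)`, for `φ` the conductance.
  excess : Carrier
  excess = K - (fromℕ-2 * fromℕ-2) / fromℕ n [ 0<n ]

  n*excess : fromℕ n * excess ≈ fromℕ n * K - fromℕ-2 * fromℕ-2
  n*excess = trans
    (solve 4 (λ N K d w → N :* (K :- d :* d :* w) := N :* K :- d :* d :* (w :* N))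
        refl (fromℕ n) K fromℕ-2 (inv (fromℕ n) 0<n))
    (+-congˡ (-‿cong (trans (*-congˡ (inv-inverseˡ (fromℕ n) 0<n)) (*-identityʳ _))))

  -- From individual cuts to the conductance.

  module _ (0<n-2 : 0# < fromℕ-2) where

    -- Adding the surplus `v * v * (c * c) * (d * d)` back to `variational-cut` leaves a positive
    -- multiple of `c * v * excess - p`. The surplus is positive because `n - 2` is, and this is the
    -- source of strictness.
    cut-excess : (C@(S , _) : Cut n) →
      vol G S * vol G (∁ S) < cutWeight G S * volume * excess
    cut-excess C@(S , _) = 0<-⇒< (0<z*x⇒0<x (*-pos (*-pos 0<n 0<n) (0<p C))
      (<-respʳ-≈ (begin
        N * N * c * v * p * K - N * N * p * p - d * d * N * c * v * p - v * v * c * c * d * d + v * v * (c * c) * (d * d)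
          ≈⟨ solve 6 (λ N c v p K d →
               N :* N :* c :* v :* p :* K :- N :* N :* p :* p :- d :* d :* N :* c :* v :* p :- v :* v :* c :* c :* d :* d
                 :+ v :* v :* (c :* c) :* (d :* d)
               := N :* c :* v :* p :* (N :* K :- d :* d) :- N :* N :* p :* p) refl N c v p K d ⟩
        N * c * v * p * (N * K - d * d) - N * N * p * p
          ≈⟨ +-congʳ (*-congˡ n*excess) ⟨
        N * c * v * p * (N * excess) - N * N * p * p
          ≈⟨ solve 5 (λ N c v p k → N :* c :* v :* p :* (N :* k) :- N :* N :* p :* p
              := N :* N :* p :* (c :* v :* k :- p)) refl N c v p excess ⟩
        N * N * p * (c * v * excess - p) ∎)
        (0≤+0< (variational-cut C)
          (*-pos (*-pos (*-pos (0<v C) (0<v C)) (*-pos (0<c C) (0<c C))) (*-pos 0<n-2 0<n-2)))))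
      where
      c p v N d : Carrier
      c = cutWeight G S
      p = vol G S * vol G (∁ S)
      v = volume
      N = fromℕ n
      d = fromℕ-2

    -- With m = min(a, b), 2ab - m(a + b) = a(b - m) + b(a - m) ≥ 0.
    minVol<excess : (C@(S , _) : Cut n) →
      vol G S ⊓ vol G (∁ S) < 2# * excess * cutWeight G S
    minVol<excess C@(S , _) = 0<-⇒< (0<z*x⇒0<x (0<v C) (<-respʳ-≈ (begin
      2# * (c * v * k - a * b) + (a * (b - m) + b * (a - m))
        ≈⟨ solve 6 (λ c v k a b m → con (+ 2) :* (c :* v :* k :- a :* b) :+ (a :* (b :- m)
            :+ b :* (a :- m)) :=
             v :* (con (+ 2) :* k :* c) :- (a :+ b) :* m) refl c v k a b m ⟩
      v * (2# * k * c) - (a + b) * m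
        ≈⟨ +-congˡ (-‿cong (*-congʳ (vol+vol∁ S))) ⟩
      v * (2# * k * c) - v * m
        ≈⟨ solve 3 (λ v x m → v :* x :- v :* m := v :* (x :- m)) refl v (2# * k * c) m ⟩
      v * (2# * k * c - m) ∎)
      (0<+0≤ (*-pos 0<2 (<⇒0<- (cut-excess C)))
        (0≤+0≤ (*-nonneg (<⇒≤ (0<a C)) (≤⇒0≤- m≤b)) (*-nonneg (<⇒≤ (0<b C)) (≤⇒0≤- m≤a))))))
      where
      c v k a b m : Carrier
      c = cutWeight G S
      v = volume
      k = excess
      a = vol G S
      b = vol G (∁ S)
      m = a ⊓ b
      m≤a : m ≤ a
      m≤a = proj₁ (⊓-infimum a b)
      m≤b : m ≤ b
      m≤b = proj₁ (proj₂ (⊓-infimum a b))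

    1<excess*cutRatio : ∀ C → 1# < 2# * excess * cutRatio G 2≤n C
    1<excess*cutRatio C@(S , _) = <-respˡ-≈ (inv-inverseˡ _ 0<m)
      (<-respʳ-≈ (solve 3 (λ k c w → w :* (con (+ 2) :* k :* c) := con (+ 2) :* k :* (c :* w))
          refl excess (cutWeight G S) (inv _ 0<m))
        (*-monoʳ-< (inv-pos _ 0<m) (minVol<excess C)))
      where
      0<m = minVol-pos G 2≤n C

    -- The sign of `excess` is not known beforehand. One cut suffices: its ratio is positive, and
    -- the product with `2# * excess` exceeds 1.
    0<2*excess : 0# < 2# * excess
    0<2*excess = 0<z*x⇒0<x (/-pos _ (minVol-pos G 2≤n C) (cutWeight-pos G C))
      (<-respʳ-≈ (*-comm _ _) (<-trans 0<1 (1<excess*cutRatio C)))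
      where
      C : Cut n
      C = head (cuts 2≤n)

    -- The reciprocal of `2# * excess` lies strictly below every cut ratio, and strictness survives
    -- a minimum over a finite list.
    1<excess*conductance : 1# < 2# * excess * conductance G 2≤n
    1<excess*conductance = <-respˡ-≈ (trans (*-comm _ _) (inv-inverseˡ _ 0<2*excess))
      (*-monoʳ-< 0<2*excess (foldr₁-⊓-greatest-< (cutRatio G 2≤n)
        (λ C → *-cancelˡ-< 0<2*excess
          (<-respˡ-≈ (sym (trans (*-comm _ _) (inv-inverseˡ _ 0<2*excess))) (1<excess*cutRatio C)))
        (cuts 2≤n)))

    bound<K : 1# / (fromℕ 2 * conductance G 2≤n) [ twice-pos (conductance-pos G 2≤n) ]
              + (fromℕ-2 * fromℕ-2) / fromℕ n [ 0<n ] < K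
    bound<K = <-respʳ-≈ (solve 2 (λ K q → K :- q :+ q := K) refl K _)
      (+-monoˡ-< _ (*-cancelˡ-< 0<2φ (<-respˡ-≈
        (sym (trans (*-comm _ _) (trans (*-congʳ (*-identityˡ _)) (inv-inverseˡ 2φ 0<2φ))))
        (<-respʳ-≈ (solve 2 (λ k φ → con (+ 2) :* k :* φ := (con (+ 1) :+ (con (+ 1)
            :+ con (+ 0))) :* φ :* k) refl excess (conductance G 2≤n))
          1<excess*conductance))))
      where
      2φ = fromℕ 2 * conductance G 2≤n
      0<2φ = twice-pos (conductance-pos G 2≤n)

corollary4p8 : ∀ {c ℓ₁ ℓ₂} (R : RealField c ℓ₁ ℓ₂) (n : ℕ) (n≥3 : 3 ℕ.≤ n) (G : WeightedGraph R n) →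
    let open RealField R
        n≥2   = ℕₚ.<⇒≤ n≥3
        φ     = conductance G n≥2
        φ>0   = conductance-pos G n≥2
        n-2   = fromℕ n - fromℕ 2
        bound = 1# / (fromℕ 2 * φ) [ twice-pos φ>0 ] + (n-2 * n-2) / fromℕ n [ fromℕ-pos (ℕₚ.<⇒≤ n≥2) ]
    in (K : Carrier) → IsKemenyConstant G n≥2 K → bound ≤ K × ¬ (K ≈ bound)
corollary4p8 R n n≥3@(s≤s (s≤s (s≤s {n = m} z≤n))) G K isKemeny =
  <⇒≤ strict , λ K≈bound → <-irrefl (sym K≈bound) strict
  where
  open RealField R
  open OrderedField R using (0<-⇒<; <⇒0<-)
  open IntegerCoefficients commutativeRing
  0<n-2 : 0# < fromℕ n - fromℕ 2
  0<n-2 = <-respʳ-≈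
    -- Here `n` is `3 + m`, and both `fromℕ n` and `fromℕ 2` are written as the nested sums to which
    -- they unfold, with `x` for `fromℕ m`.
    (solve 1 (λ x → con (+ 1) :+ x := con (+ 1) :+ (con (+ 1) :+ (con (+ 1) :+ x)) :- (con (+ 1)
        :+ (con (+ 1) :+ con (+ 0))))
      refl (fromℕ m))
    (fromℕ-pos {suc m} (s≤s z≤n))
  strict = Bound.bound<K G (ℕₚ.<⇒≤ n≥3) isKemeny 0<n-2
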